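{- Let $\beta\ge1$ and consider the $\beta$-sampling game, with $\rho_j$ the average weight of the surviving elements in round $j$ and $\mathcal{E}_j$ the $\sigma$-algebra of the history through round $j$. For every adversary and all integers $0\le s<k$, $$\mathbf{E}[\rho_k\mid\mathcal{E}_s]\le\beta^2\rho_s .$$
   Context: The $\beta$-sampling game ($\beta\ge1$). Initially there is a finite set $\mathcal{S}_0$ of $m$ elements, each $A\in\mathcal{S}_0$ having a weight $w_0(A)\ge0$. In round $j$, $\mathcal{S}_j$ is the set of surviving elements and $w_j:\mathcal{S}_j\to\mathbb{R}_{\ge0}$ their weight function; $w_j(\mathcal{S}_j):=\sum_{A\in\mathcal{S}_j}w_j(A)$ and $\rho_j:=w_j(\mathcal{S}_j)/|\mathcal{S}_j|$. After observing the state through round $j$, the adversary chooses an $\mathcal{E}_j$-measurable deletion probability $d_{j+1}\in[0,1]$, and a fresh Bernoulli variable $D_{j+1}$ is drawn with $\Pr(D_{j+1}=1\mid\mathcal{E}_j)=d_{j+1}$. (1) If $D_{j+1}=0$, then $\mathcal{S}_{j+1}=\mathcal{S}_j$ and the adversary chooses a new weight function with $0\le w_{j+1}(A)\le w_j(A)$ for every $A\in\mathcal{S}_j$. (2) If $D_{j+1}=1$, the adversary chooses a probability distribution $\pi_j$ on $\mathcal{S}_j$ with $\beta^{ -1}\frac{w_j(A)}{w_j(\mathcal{S}_j)}\le\pi_j(A)\le\beta\frac{w_j(A)}{w_j(\mathcal{S}_j)}$ for every $A\in\mathcal{S}_j$; an element $A^*\sim\pi_j$ is sampled and deleted, $\mathcal{S}_{j+1}=\mathcal{S}_j\setminus\{A^*\}$;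 finally the adversary chooses a new weight function with $0\le w_{j+1}(A)\le w_j(A)$ for every $A\in\mathcal{S}_{j+1}$. Here $\mathcal{E}_j$ is the $\sigma$-algebra generated by the complete history through round $j$, including the adversary's past decisions and randomness. The choices of $d_{j+1}$ and (when $D_{j+1}=1$) of $\pi_j$ are $\mathcal{E}_j$-measurable; any internal randomness used to make them is included in the history before $A^*$ is sampled. In particular $\mathcal{S}_j,w_j,\rho_j$ are $\mathcal{E}_j$-measurable. If $\mathcal{S}_j=\varnothing$ or $w_j(\mathcal{S}_j)=0$, the game stops and $\rho_\ell:=0$ for every $\ell\ge j$. -}

module Defs where

open import Level using (0ℓ) renaming (suc to lsuc)
open import Algebra.Bundles using (CommutativeRing)
open import Data.Bool.Base using (Bool; true; false; if_then_else_)
open import Data.Fin.Base using (Fin; toℕ)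
open import Data.Fin.Subset as Subset using (Subset; ∣_∣)
open import Data.Fin.Subset.Properties using (_∈?_; nonempty?)
open import Data.Maybe.Base using (Maybe; just; nothing)
open import Data.Nat.Base as ℕ using (ℕ; suc)
open import Data.Nat.Properties using (anyUpTo?)
open import Data.Product using (∃; ∃-syntax; Σ-syntax; _×_)
open import Data.Sum.Base using (_⊎_)
open import Relation.Binary.Bundles using (TotalOrder)
open import Relation.Binary.PropositionalEquality.Core using (_≡_; _≢_)
open import Relation.Binary.Structures using (IsDecTotalOrder)
open import Relation.Nullary.Decidable using (Dec; does; ¬?; _⊎-dec_)
open import Relation.Nullary.Negation using (¬_)
open import Relation.Unary
  using (Pred; U; ∅; ∁; _∈_; _⊆_; _∩_; _∪_; _≐_; ｛_｝; ⋃; Empty; Satisfiable)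

import Algebra.Construct.NaturalChoice.Max as Max
import Algebra.Properties.Semiring.Mult as Mult
import Algebra.Properties.Semiring.Sum as Sum

-- The real numbers, axiomatised in the classical way (unique up to
-- isomorphism).  The value of `0# ⁻¹` is unspecified.
record RealNumbers : Set₁ where
  infix  4 _≤_
  infixl 7 _/_
  infix  8 _⁻¹
  field
    commutativeRing : CommutativeRing 0ℓ 0ℓ
  open CommutativeRing commutativeRing public renaming (Carrier to ℝ)
  field
    _≤_             : ℝ → ℝ → Set
    isDecTotalOrder : IsDecTotalOrder _≈_ _≤_
    +-monoˡ-≤       : ∀ {x y} z → x ≤ y → x + z ≤ y + z
    *-nonNegative   : ∀ {x y} → 0# ≤ x → 0# ≤ y → 0# ≤ x * y
    0≉1             : ¬ 0# ≈ 1#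
    _⁻¹             : ℝ → ℝ
    ⁻¹-cong         : ∀ {x y} → x ≈ y → x ⁻¹ ≈ y ⁻¹
    ⁻¹-inverseʳ     : ∀ {x} → ¬ x ≈ 0# → x * x ⁻¹ ≈ 1#

  IsUpperBound : ∀ {ℓ} → Pred ℝ ℓ → ℝ → Set ℓ
  IsUpperBound X b = ∀ {x} → x ∈ X → x ≤ b

  IsSup : ∀ {ℓ} → Pred ℝ ℓ → ℝ → Set ℓ
  IsSup X s = IsUpperBound X s × (∀ {b} → IsUpperBound X b → s ≤ b)

  field
    complete : (X : Pred ℝ 0ℓ) → Satisfiable X → ∃ (IsUpperBound X) →
               ∃ (IsSup X)

  open IsDecTotalOrder isDecTotalOrder public
    using (isTotalOrder; _≤?_) renaming (_≟_ to _≈?_)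

  totalOrder : TotalOrder 0ℓ 0ℓ 0ℓ
  totalOrder = record { isTotalOrder = isTotalOrder }

  open Max totalOrder public using (_⊔_)
  open Sum semiring public using (sum)
  open Mult semiring public using () renaming (_×_ to _·_)

  _/_ : ℝ → ℝ → ℝ
  x / y = x * y ⁻¹

  fromℕ : ℕ → ℝ
  fromℕ n = n · 1#

Event : Set → Set₁
Event Ω = Pred Ω 0ℓ

-- Events are predicates, so σ-algebras are required to respect
-- extensional equality `_≐_`.
record SigmaAlgebra (Ω : Set) : Set₂ where
  field
    Measurable   : Pred (Event Ω) (lsuc 0ℓ)
    ≐-closed     : ∀ {B C} → B ≐ C → Measurable B → Measurable C
    U-measurable : Measurable U
    ∁-measurable : ∀ {B} → Measurable B → Measurable (∁ B)
    ⋃-measurable : ∀ {B : ℕ → Event Ω} → (∀ n → Measurable (B n)) →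
                   Measurable (⋃ ℕ B)

open SigmaAlgebra public using (Measurable)

data Generated {Ω : Set} (𝒢 : Pred (Event Ω) (lsuc 0ℓ)) :
               Pred (Event Ω) (lsuc 0ℓ) where
  generator  : ∀ {B} → 𝒢 B → Generated 𝒢 B
  ≐-closure  : ∀ {B C} → B ≐ C → Generated 𝒢 B → Generated 𝒢 C
  universe   : Generated 𝒢 U
  complement : ∀ {B} → Generated 𝒢 B → Generated 𝒢 (∁ B)
  union      : ∀ {B : ℕ → Event Ω} → (∀ n → Generated 𝒢 (B n)) →
               Generated 𝒢 (⋃ ℕ B)

σ : {Ω : Set} → Pred (Event Ω) (lsuc 0ℓ) → SigmaAlgebra Ω
σ 𝒢 = record
  { Measurable   = Generated 𝒢
  ; ≐-closed     = ≐-closure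
  ; U-measurable = universe
  ; ∁-measurable = complement
  ; ⋃-measurable = union
  }

module Probability (R : RealNumbers) where
  open RealNumbers R

  PairwiseDisjoint : {I Ω : Set} → (I → Event Ω) → Set
  PairwiseDisjoint B = ∀ {i j} → i ≢ j → Empty (B i ∩ B j)

  -- `P` is total on predicates; only its values on measurable events are
  -- constrained or used.  A series of nonnegative terms has as its sum the
  -- supremum of its partial sums.
  record ProbabilitySpace (Ω : Set) : Set₂ where
    field
      𝓕          : SigmaAlgebra Ω
      P          : Event Ω → ℝ
      P-cong     : ∀ {B C} → Measurable 𝓕 B → B ≐ C → P B ≈ P C
      P-nonneg   : ∀ {B} → Measurable 𝓕 B → 0# ≤ P B
      P-total    : P U ≈ 1#
      P-additive : ∀ {B : ℕ → Event Ω} → (∀ n → Measurable 𝓕 (B n)) →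
                   PairwiseDisjoint B →
                   IsSup (λ x → ∃[ n ] x ≈ sum {n} (λ i → P (B (toℕ i))))
                         (P (⋃ ℕ B))

  module _ {Ω : Set} where

    MeasurableOn : SigmaAlgebra Ω → Event Ω → (Ω → ℝ) → Set₁
    MeasurableOn 𝓖 H f = ∀ r → Measurable 𝓖 (H ∩ λ ω → f ω ≤ r)

    module _ (prob : ProbabilitySpace Ω) where
      open ProbabilitySpace prob

      -- `SimpleIntegral f G x`: x is the integral of a nonnegative simple
      -- function Σᵢ cᵢ 1_{Bᵢ} (Bᵢ ⊆ G disjoint) that lies below f on the Bᵢ.
      SimpleIntegral : (Ω → ℝ) → Event Ω → Pred ℝ (lsuc 0ℓ)
      SimpleIntegral f G x =
        ∃[ n ] Σ[ c ∈ (Fin n → ℝ) ] Σ[ B ∈ (Fin n → Event Ω) ]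
          (∀ i → Measurable 𝓕 (B i)) ×
          PairwiseDisjoint B ×
          (∀ i → B i ⊆ G) ×
          (∀ i → 0# ≤ c i) ×
          (∀ i {ω} → ω ∈ B i → c i ≤ f ω) ×
          x ≈ sum (λ i → c i * P (B i))

      IsIntegral⁺ : (Ω → ℝ) → Event Ω → ℝ → Set₁
      IsIntegral⁺ f G = IsSup (SimpleIntegral f G)

      -- The Lebesgue integral ∫_G f dP exists, is finite and equals v.
      IsIntegral : (Ω → ℝ) → Event Ω → ℝ → Set₁
      IsIntegral f G v = ∃[ a ] ∃[ b ]
        IsIntegral⁺ (λ ω → f ω ⊔ 0#) G a ×
        IsIntegral⁺ (λ ω → (- f ω) ⊔ 0#) G b ×
        v ≈ a - b

      -- Y is a version of E[X | 𝓖].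
      IsCondExp : SigmaAlgebra Ω → (Ω → ℝ) → (Ω → ℝ) → Set₁
      IsCondExp 𝓖 X Y =
        MeasurableOn 𝓖 U Y ×
        (∀ {G} → Measurable 𝓖 G →
           ∃[ v ] IsIntegral X G v × IsIntegral Y G v)

      -- On the event H ∈ 𝓖, f is a version of P(B | 𝓖).
      IsCondProbOn : SigmaAlgebra Ω → Event Ω → Event Ω → (Ω → ℝ) → Set₁
      IsCondProbOn 𝓖 H B f =
        MeasurableOn 𝓖 H f ×
        (∀ {G} → Measurable 𝓖 G → G ⊆ H → IsIntegral f G (P (G ∩ B)))

      AlmostSurely : Event Ω → Set₁
      AlmostSurely B = ∃[ N ] Measurable 𝓕 N × P N ≈ 0# × ∁ B ⊆ N

module Game (R : RealNumbers) where
  open RealNumbers R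
  open Probability R

  -- The random quantities occurring in a play.  At index j, `d`, `D`, `π`
  -- and `A*` are those of the round leading from state j to state j+1 (so `d`
  -- and `D` are d_{j+1} and D_{j+1}).  `w j ω A` is meaningful only for
  -- A ∈ S j ω, and `π j ω A` only if moreover D j ω ≡ true.  `Random j` is a
  -- family of events generating the adversary's internal randomness added to
  -- the history in round j.
  record Play (Ω : Set) (m : ℕ) : Set₂ where
    field
      S      : ℕ → Ω → Subset m
      w      : ℕ → Ω → Fin m → ℝ
      d      : ℕ → Ω → ℝ
      D      : ℕ → Ω → Bool
      π      : ℕ → Ω → Fin m → ℝ
      A*     : ℕ → Ω → Maybe (Fin m)
      Random : ℕ → Pred (Event Ω) (lsuc 0ℓ)

    sumOver : Subset m → (Fin m → ℝ) → ℝ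
    sumOver T f = sum (λ A → if does (A ∈? T) then f A else 0#)

    W : ℕ → Ω → ℝ
    W j ω = sumOver (S j ω) (w j ω)

    Terminal : ℕ → Event Ω
    Terminal j ω = Subset.Empty (S j ω) ⊎ W j ω ≈ 0#

    Stopped : ℕ → Event Ω
    Stopped j ω = ∃[ i ] i ℕ.< suc j × Terminal i ω

    Live : ℕ → Event Ω
    Live j = ∁ (Stopped j)

    terminal? : ∀ j ω → Dec (Terminal j ω)
    terminal? j ω = ¬? (nonempty? (S j ω)) ⊎-dec (W j ω ≈? 0#)

    stopped? : ∀ j ω → Dec (Stopped j ω)
    stopped? j ω = anyUpTo? (λ i → terminal? i ω) (suc j)

    ρ : ℕ → Ω → ℝ
    ρ j ω = if does (stopped? j ω) then 0# else W j ω / fromℕ ∣ S j ω ∣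

    Coin : ℕ → Event Ω
    Coin j ω = D j ω ≡ true

    Surviving : ℕ → Fin m → Event Ω
    Surviving j A ω = A Subset.∈ S j ω

    Sampled : ℕ → Fin m → Event Ω
    Sampled j A ω = A* j ω ≡ just A

    -- Generators of the history through round j.  Only rounds that are
    -- actually played, and only the meaningful values of w and π, contribute.
    -- S 0 and w 0 are deterministic.
    data History (j : ℕ) : Pred (Event Ω) (lsuc 0ℓ) where
      internal : ∀ {i B} → i ℕ.≤ j → Random i B → History j B
      chance   : ∀ {i} → i ℕ.< j → ∀ r →
                 History j (Live i ∩ λ ω → d i ω ≤ r)
      coin     : ∀ {i} → i ℕ.< j → History j (Live i ∩ Coin i)
      law      : ∀ {i} → i ℕ.< j → ∀ A r →
                 History j (Live i ∩ Coin i ∩ Surviving i A ∩ λ ω → π i ω A ≤ r)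
      sample   : ∀ {i} → i ℕ.< j → ∀ A →
                 History j (Live i ∩ Coin i ∩ Sampled i A)
      survival : ∀ {i} → i ℕ.< j → ∀ A →
                 History j (Live i ∩ Surviving (suc i) A)
      weight   : ∀ {i} → i ℕ.< j → ∀ A r →
                 History j (Live i ∩ Surviving (suc i) A ∩
                            λ ω → w (suc i) ω A ≤ r)

    𝓔 : ℕ → SigmaAlgebra Ω
    𝓔 j = σ (History j)

    -- The history just before A* is sampled.
    𝓔⁺ : ℕ → SigmaAlgebra Ω
    𝓔⁺ j = σ (Measurable (𝓔 j) ∪ ｛ Live j ∩ Coin j ｝)

  record IsSamplingGame {Ω : Set} (prob : ProbabilitySpace Ω) (β : ℝ)
                        {m : ℕ} (w₀ : Fin m → ℝ) (play : Play Ω m) : Set₂ where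
    open ProbabilitySpace prob
    open Play play
    field
      measurable : ∀ {j} → History j ⊆ Measurable 𝓕

      S-init : ∀ ω → S 0 ω ≡ Subset.⊤
      w-init : ∀ ω A → w 0 ω A ≈ w₀ A

      d-range : ∀ j {ω} → ω ∈ Live j → 0# ≤ d j ω × d j ω ≤ 1#
      D-law   : ∀ j → IsCondProbOn prob (𝓔 j) (Live j) (Coin j) (d j)

      S-keep   : ∀ j {ω} → ω ∈ Live j → D j ω ≡ false →
                 A* j ω ≡ nothing × S (suc j) ω ≡ S j ω
      S-delete : ∀ j {ω} → ω ∈ Live j → D j ω ≡ true →
                 ∃[ A ] A* j ω ≡ just A × A Subset.∈ S j ω ×
                        S (suc j) ω ≡ S j ω Subset.- A

      π-measurable : ∀ j A → MeasurableOn (𝓔 j) (Live j ∩ Surviving j A)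
                                          (λ ω → π j ω A)
      π-nonneg     : ∀ j {ω} → ω ∈ Live j → D j ω ≡ true →
                     ∀ {A} → A Subset.∈ S j ω → 0# ≤ π j ω A
      π-total      : ∀ j {ω} → ω ∈ Live j → D j ω ≡ true →
                     sumOver (S j ω) (π j ω) ≈ 1#
      π-bounds     : ∀ j {ω} → ω ∈ Live j → D j ω ≡ true →
                     ∀ {A} → A Subset.∈ S j ω →
                     β ⁻¹ * (w j ω A / W j ω) ≤ π j ω A ×
                     π j ω A ≤ β * (w j ω A / W j ω)
      A*-law       : ∀ j A → IsCondProbOn prob (𝓔⁺ j)
                                          (Live j ∩ Coin j ∩ Surviving j A)
                                          (Sampled j A) (λ ω → π j ω A)

      w-step : ∀ j {ω} → ω ∈ Live j → ∀ {A} → A Subset.∈ S (suc j) ω →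
               0# ≤ w (suc j) ω A × w (suc j) ω A ≤ w j ω A

{-# OPTIONS --safe #-}
module Submission where

-- Fix a threshold τ ≥ 0 and call a surviving element heavy if its weight
-- exceeds β²τ and light if its weight is at most τ.  A heavy element is at
-- least as likely to be sampled as a light one (both probabilities compare with
-- βτ / w_j(S_j)), and weights only decrease, so the fraction v / (v + u) of
-- heavy elements among the v heavy and u light ones is a supermartingale.
-- Summing the layers τ = 0, η, 2η, … turns v_k / n_k ≤ v_k / (v_k + u_k) into an
-- upper bound for ρ_k, and v_s / (v_s + u_s) ≤ 1 - u_s / n_s into the bound
-- β² (ρ_s + η) for the initial value; finally η tends to 0.

open import Level using (0ℓ) renaming (suc to lsuc)
open import Axiom.ExcludedMiddle using (ExcludedMiddle)
open import Data.Bool.Base using (true; false; if_then_else_)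
open import Data.Fin.Base using (Fin; zero; suc; toℕ)
open import Data.Fin.Properties using (_≟_)
open import Data.Fin.Subset as Subset using (Subset; ∣_∣; inside; outside)
open import Data.Fin.Subset.Properties using (_∈?_; ∈⊤; p─q⊆p; x∈p∧x≢y⇒x∈p-y; x∈⁅x⁆; drop-there)
open import Data.Maybe.Base using (just)
open import Data.Maybe.Properties using (just-injective)
open import Data.Nat.Base as ℕ using (ℕ; zero; suc; s≤s)
open import Data.Nat.Induction using (<-rec)
import Data.Nat.Properties as ℕ
open import Data.Product using (∃; _×_; _,_; proj₁; proj₂)
open import Data.Sum.Base using (_⊎_; inj₁; inj₂; [_,_]′)
open import Data.Unit.Base using (tt)
open import Data.Vec.Base using ([]; _∷_; here; there)
open import Function.Base using (_∘_; id)
open import Relation.Binary.Bundles using (TotalOrder)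
open import Relation.Binary.Definitions using (tri<; tri≈; tri>)
open import Relation.Binary.PropositionalEquality.Core as ≡ using (_≡_; _≢_)
open import Relation.Nullary.Decidable using (Dec; yes; no; does; decidable-stable; toSum)
open import Relation.Nullary.Negation using (¬_; contradiction)
open import Relation.Unary using (U; ∁; _∈_; _⊆_; _∩_; _∪_; _≐_; ⋃; Empty; Satisfiable)
import Algebra.Construct.NaturalChoice.Max as Max
import Algebra.Construct.NaturalChoice.MaxOp as MaxOp
import Algebra.Properties.CommutativeSemigroup as CommutativeSemigroupProperties
import Algebra.Properties.Ring as RingProperties
import Algebra.Properties.Semiring.Sum as SumProperties
import Algebra.Solver.Ring.NaturalCoefficients.Default as SemiringSolver
import Relation.Binary.Reasoning.PartialOrder as PosetReasoning
open import Defs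

-- For β > 1 the average `ρ` itself can grow in expectation within one round: nearly equal weights
-- may be sampled with a bias towards the lighter ones, and bounds taken round by round would
-- multiply. At a fixed threshold the gap between `τ` and `β * β * τ` absorbs this bias afresh in
-- every round, so the fraction loses nothing however long the play is. The factor β² is paid only
-- once, as the ratio between the spacing of the heavy thresholds and that of the light ones.
--
-- The other obstacle is integration. `IsIntegral` is defined by suprema over simple functions, so
-- the processes are built as explicit simple expressions whose expectation is computed by
-- recursion. The integrals of `ρ k` and of the given version of the conditional expectation enter
-- only through one-sided comparisons on events of `𝓔 s`, and the almost sure statement comes from
-- testing on events where the bound fails by a fixed margin.

-- Ordered-field arithmetic.

module RealProperties (R : RealNumbers) where
  open RealNumbers R hiding (zero)
  open TotalOrder totalOrder public
    using (poset; total) renaming (refl to ≤-refl; reflexive to ≤-reflexive; trans to ≤-trans; antisym to ≤-antisym)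
  open RingProperties ring public using (-‿distribˡ-*; -‿involutive; -0#≈0#)
  open SemiringSolver commutativeSemiring using (solve; _:=_; _:+_; _:*_; con)
  open PosetReasoning poset

  infix 4 _<_

  -- A negation, so that the `no` case of `_≤?_` is a strict inequality and the complement of the
  -- event `f ≤ r` is literally the event `r < f`.
  _<_ : ℝ → ℝ → Set
  x < y = ¬ y ≤ x

  <⇒≤ : ∀ {x y} → x < y → x ≤ y
  <⇒≤ {x} {y} x<y with total x y
  ... | inj₁ x≤y = x≤y
  ... | inj₂ y≤x = contradiction y≤x x<y

  ≤-<-trans : ∀ {x y z} → x ≤ y → y < z → x < z
  ≤-<-trans x≤y y<z z≤x = y<z (≤-trans z≤x x≤y)

  <-≤-trans : ∀ {x y z} → x < y → y ≤ z → x < z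
  <-≤-trans x<y y≤z z≤x = x<y (≤-trans y≤z z≤x)

  <⇒≉ : ∀ {x y} → x < y → ¬ y ≈ x
  <⇒≉ x<y y≈x = x<y (≤-reflexive y≈x)

  ≤∧≉⇒< : ∀ {x y} → x ≤ y → ¬ y ≈ x → x < y
  ≤∧≉⇒< x≤y y≉x y≤x = y≉x (≤-antisym y≤x x≤y)

  +-mono-≤ : ∀ {x y u v} → x ≤ y → u ≤ v → x + u ≤ y + v
  +-mono-≤ {x} {y} {u} {v} x≤y u≤v = begin
    x + u ≤⟨ +-monoˡ-≤ u x≤y ⟩
    y + u ≈⟨ +-comm y u ⟩
    u + y ≤⟨ +-monoˡ-≤ y u≤v ⟩
    v + y ≈⟨ +-comm v y ⟩
    y + v ∎

  +-monoʳ-≤ : ∀ {u v} x → u ≤ v → x + u ≤ x + v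
  +-monoʳ-≤ x = +-mono-≤ ≤-refl

  private
    x+z-z≈x : ∀ x z → (x + z) - z ≈ x
    x+z-z≈x x z = trans (+-assoc x z (- z)) (trans (+-congˡ (-‿inverseʳ z)) (+-identityʳ x))

  -+-cancel : ∀ x z → (x - z) + z ≈ x
  -+-cancel x z = trans (+-assoc x (- z) z) (trans (+-congˡ (-‿inverseˡ z)) (+-identityʳ x))

  +-cancelʳ-≤ : ∀ {x y} z → x + z ≤ y + z → x ≤ y
  +-cancelʳ-≤ {x} {y} z x+z≤y+z = begin
    x           ≈⟨ x+z-z≈x x z ⟨
    (x + z) - z ≤⟨ +-monoˡ-≤ (- z) x+z≤y+z ⟩
    (y + z) - z ≈⟨ x+z-z≈x y z ⟩
    y           ∎

  x+z≤y⇒x≤y-z : ∀ {x y z} → x + z ≤ y → x ≤ y - z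
  x+z≤y⇒x≤y-z {x} {y} {z} le = +-cancelʳ-≤ z (≤-trans le (≤-reflexive (sym (-+-cancel y z))))

  x-z≤y⇒x≤y+z : ∀ {x y z} → x - z ≤ y → x ≤ y + z
  x-z≤y⇒x≤y+z {x} {y} {z} le = ≤-trans (≤-reflexive (sym (-+-cancel x z))) (+-monoˡ-≤ z le)

  x≤y+z⇒x-z≤y : ∀ {x y z} → x ≤ y + z → x - z ≤ y
  x≤y+z⇒x-z≤y {x} {y} {z} le = ≤-trans (+-monoˡ-≤ (- z) le) (≤-reflexive (x+z-z≈x y z))

  neg-mono-≤ : ∀ {x y} → x ≤ y → - y ≤ - x
  neg-mono-≤ {x} {y} x≤y = +-cancelʳ-≤ y (begin
    - y + y  ≈⟨ -‿inverseˡ y ⟩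
    0#       ≈⟨ -‿inverseˡ x ⟨
    - x + x  ≤⟨ +-monoʳ-≤ (- x) x≤y ⟩
    - x + y  ∎)

  x≤x+nonneg : ∀ {x y} → 0# ≤ y → x ≤ x + y
  x≤x+nonneg {x} 0≤y = ≤-trans (≤-reflexive (sym (+-identityʳ x))) (+-monoʳ-≤ x 0≤y)

  +-nonneg : ∀ {x y} → 0# ≤ x → 0# ≤ y → 0# ≤ x + y
  +-nonneg 0≤x 0≤y = ≤-trans 0≤x (x≤x+nonneg 0≤y)

  *-monoʳ-≤ : ∀ {z x y} → 0# ≤ z → x ≤ y → z * x ≤ z * y
  *-monoʳ-≤ {z} {x} {y} 0≤z x≤y = begin
    z * x               ≤⟨ x≤x+nonneg (*-nonNegative 0≤z (x+z≤y⇒x≤y-z (≤-trans (≤-reflexive (+-identityˡ x)) x≤y))) ⟩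
    z * x + z * (y - x) ≈⟨ distribˡ z x (y - x) ⟨
    z * (x + (y - x))   ≈⟨ *-congˡ (trans (+-comm x (y - x)) (-+-cancel y x)) ⟩
    z * y               ∎

  *-monoˡ-≤ : ∀ {z x y} → 0# ≤ z → x ≤ y → x * z ≤ y * z
  *-monoˡ-≤ {z} {x} {y} 0≤z x≤y = begin
    x * z ≈⟨ *-comm x z ⟩
    z * x ≤⟨ *-monoʳ-≤ 0≤z x≤y ⟩
    z * y ≈⟨ *-comm z y ⟩
    y * z ∎

  0≤1 : 0# ≤ 1#
  0≤1 with total 0# 1#
  ... | inj₁ le = le
  ... | inj₂ 1≤0 = begin
    0#              ≤⟨ *-nonNegative 0≤-1 0≤-1 ⟩
    - 1# * - 1#     ≈⟨ -‿distribˡ-* 1# (- 1#) ⟨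
    - (1# * - 1#)   ≈⟨ -‿cong (*-identityˡ (- 1#)) ⟩
    - - 1#          ≈⟨ -‿involutive 1# ⟩
    1#              ∎
    where
    0≤-1 : 0# ≤ - 1#
    0≤-1 = ≤-trans (≤-reflexive (sym -0#≈0#)) (neg-mono-≤ 1≤0)

  0<1 : 0# < 1#
  0<1 1≤0 = 0≉1 (≤-antisym 0≤1 1≤0)

  ⁻¹-nonneg : ∀ {x} → 0# < x → 0# ≤ x ⁻¹
  ⁻¹-nonneg {x} 0<x with total 0# (x ⁻¹)
  ... | inj₁ le = le
  ... | inj₂ x⁻¹≤0 = contradiction (begin
    1#        ≈⟨ ⁻¹-inverseʳ (<⇒≉ 0<x) ⟨
    x * x ⁻¹  ≤⟨ *-monoʳ-≤ (<⇒≤ 0<x) x⁻¹≤0 ⟩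
    x * 0#    ≈⟨ zeroʳ x ⟩
    0#        ∎) 0<1

  /-cong : ∀ {x x′ y y′} → x ≈ x′ → y ≈ y′ → x / y ≈ x′ / y′
  /-cong x≈x′ y≈y′ = *-cong x≈x′ (⁻¹-cong y≈y′)

  /-congˡ : ∀ {x y y′} → y ≈ y′ → x / y ≈ x / y′
  /-congˡ = /-cong refl

  0/x≈0 : ∀ {x y} → x ≈ 0# → x / y ≈ 0#
  0/x≈0 x≈0 = trans (*-congʳ x≈0) (zeroˡ _)

  *-/-cancel : ∀ {x y} → 0# < y → (x * y) / y ≈ x
  *-/-cancel {x} {y} 0<y = trans (*-assoc x y (y ⁻¹)) (trans (*-congˡ (⁻¹-inverseʳ (<⇒≉ 0<y))) (*-identityʳ x))

  /-*-cancel : ∀ {x y} → 0# < y → (x / y) * y ≈ x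
  /-*-cancel {x} {y} 0<y = trans (*-assoc x (y ⁻¹) y) (trans (*-congˡ (trans (*-comm (y ⁻¹) y) (⁻¹-inverseʳ (<⇒≉ 0<y)))) (*-identityʳ x))

  x≤z*y⇒x/y≤z : ∀ {x y z} → 0# < y → x ≤ z * y → x / y ≤ z
  x≤z*y⇒x/y≤z 0<y le = ≤-trans (*-monoˡ-≤ (⁻¹-nonneg 0<y) le) (≤-reflexive (*-/-cancel 0<y))

  /-nonneg : ∀ {x y} → 0# ≤ x → 0# < y → 0# ≤ x / y
  /-nonneg 0≤x 0<y = *-nonNegative 0≤x (⁻¹-nonneg 0<y)

  cross-≤ : ∀ {a b c d} → 0# < b → 0# < d → a * d ≤ c * b → a / b ≤ c / d
  cross-≤ {a} {b} {c} {d} 0<b 0<d le = x≤z*y⇒x/y≤z 0<b (begin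
    a             ≈⟨ *-/-cancel 0<d ⟨
    (a * d) / d   ≤⟨ *-monoˡ-≤ (⁻¹-nonneg 0<d) le ⟩
    (c * b) / d   ≈⟨ solve 3 (λ c b e → (c :* b) :* e := (c :* e) :* b) refl c b (d ⁻¹) ⟩
    (c / d) * b   ∎)

  -- The case v = u = 0 is included: 0 / y = 0 whatever the junk value of y ⁻¹.
  fraction-mono : ∀ {v v′ u u′} → 0# ≤ v′ → v′ ≤ v → 0# ≤ u → u ≤ u′ →
                  v′ / (v′ + u′) ≤ v / (v + u)
  fraction-mono {v} {v′} {u} {u′} 0≤v′ v′≤v 0≤u u≤u′ with v ≤? 0#
  ... | yes v≤0 = ≤-reflexive (trans (0/x≈0 v′≈0) (sym (0/x≈0 v≈0)))
    where
    v≈0  = ≤-antisym v≤0 (≤-trans 0≤v′ v′≤v)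
    v′≈0 = ≤-antisym (≤-trans v′≤v v≤0) 0≤v′
  ... | no 0<v with v′ ≤? 0#
  ...   | yes v′≤0 = ≤-trans (≤-reflexive (0/x≈0 (≤-antisym v′≤0 0≤v′)))
                       (/-nonneg (<⇒≤ 0<v) (<-≤-trans 0<v (x≤x+nonneg 0≤u)))
  ...   | no 0<v′ = cross-≤ (<-≤-trans 0<v′ (x≤x+nonneg (≤-trans 0≤u u≤u′))) (<-≤-trans 0<v (x≤x+nonneg 0≤u)) (begin
    v′ * (v + u)     ≈⟨ distribˡ v′ v u ⟩
    v′ * v + v′ * u  ≤⟨ +-mono-≤ (≤-reflexive (*-comm v′ v)) (≤-trans (*-monoˡ-≤ 0≤u v′≤v) (*-monoʳ-≤ (<⇒≤ 0<v) u≤u′)) ⟩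
    v * v′ + v * u′  ≈⟨ distribˡ v v′ u′ ⟨
    v * (v′ + u′)    ∎)

  fraction-nonneg : ∀ {v u} → 0# ≤ v → 0# ≤ u → 0# ≤ v / (v + u)
  fraction-nonneg {v} {u} 0≤v 0≤u = ≤-trans (≤-reflexive (sym (0/x≈0 refl))) (fraction-mono ≤-refl 0≤v 0≤u ≤-refl)

  -- With `n = v + u` this is 1 / (n (n - 1)), that is 1 / (n - 1) - 1 / n.
  κ : ℝ → ℝ → ℝ
  κ v u = ((v + u) - 1#) ⁻¹ * (v + u) ⁻¹

  -- Removing one unit from v, respectively from u, changes v / (v + u) by
  -- - κ v u * u, respectively by κ v u * v.
  module _ {v u : ℝ} (1≤v : 1# ≤ v) (1≤u : 1# ≤ u) where
    private
      m  = v + u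
      m′ = m - 1#

      m′+1≈m : m′ + 1# ≈ m
      m′+1≈m = -+-cancel m 1#

      0<m : 0# < m
      0<m = <-≤-trans 0<1 (≤-trans 1≤v (x≤x+nonneg (≤-trans 0≤1 1≤u)))

      0<m′ : 0# < m′
      0<m′ = <-≤-trans 0<1 (x+z≤y⇒x≤y-z (+-mono-≤ 1≤v 1≤u))

      cancel-m′ : ∀ x → x * m ⁻¹ ≈ (x * m′) * (m′ ⁻¹ * m ⁻¹)
      cancel-m′ x = trans (*-congʳ (sym (*-/-cancel 0<m′)))
        (solve 4 (λ x a b c → ((x :* a) :* b) :* c := (x :* a) :* (b :* c)) refl x m′ (m′ ⁻¹) (m ⁻¹))

      cancel-m : ∀ x → x * m′ ⁻¹ ≈ (x * m) * (m′ ⁻¹ * m ⁻¹)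
      cancel-m x = trans (*-congʳ (sym (*-/-cancel 0<m)))
        (solve 4 (λ x a b c → ((x :* a) :* c) :* b := (x :* a) :* (b :* c)) refl x m (m′ ⁻¹) (m ⁻¹))

    κ-nonneg : 0# ≤ κ v u
    κ-nonneg = *-nonNegative (⁻¹-nonneg 0<m′) (⁻¹-nonneg 0<m)

    private
      v₁ = v - 1#
      u₁ = u - 1#

      v₁+u≈m′ : v₁ + u ≈ m′
      v₁+u≈m′ = trans (+-assoc v (- 1#) u) (trans (+-congˡ (+-comm (- 1#) u)) (sym (+-assoc v u (- 1#))))

      v+u₁≈m′ : v + u₁ ≈ m′
      v+u₁≈m′ = sym (+-assoc v u (- 1#))

    fraction-remove-v : v₁ / (v₁ + u) + κ v u * u ≈ v / (v + u)
    fraction-remove-v = begin-equality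
      v₁ / (v₁ + u) + κ v u * u           ≈⟨ +-cong (/-congˡ v₁+u≈m′) (*-comm _ u) ⟩
      v₁ / m′ + u * κ v u                 ≈⟨ +-congʳ (cancel-m v₁) ⟩
      (v₁ * m) * κ v u + u * κ v u        ≈⟨ distribʳ (κ v u) (v₁ * m) u ⟨
      (v₁ * m + u) * κ v u                ≈⟨ *-congʳ numerators ⟩
      (v * m′) * κ v u                    ≈⟨ cancel-m′ v ⟨
      v / m                               ∎
      where
      numerators : v₁ * m + u ≈ v * m′
      numerators = begin-equality
        v₁ * m + u              ≈⟨ +-congʳ (*-congˡ (trans (sym m′+1≈m) (+-congʳ (sym v₁+u≈m′)))) ⟩
        v₁ * ((v₁ + u) + 1#) + u ≈⟨ solve 2 (λ a b → a :* ((a :+ b) :+ con 1) :+ b := (a :+ con 1) :* (a :+ b)) refl v₁ u ⟩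
        (v₁ + 1#) * (v₁ + u)    ≈⟨ *-cong (-+-cancel v 1#) v₁+u≈m′ ⟩
        v * m′                  ∎

    fraction-remove-u : v / (v + u₁) ≈ v / (v + u) + κ v u * v
    fraction-remove-u = begin-equality
      v / (v + u₁)                     ≈⟨ /-congˡ v+u₁≈m′ ⟩
      v / m′                           ≈⟨ cancel-m v ⟩
      (v * m) * κ v u                  ≈⟨ *-congʳ (trans (*-congˡ (sym m′+1≈m)) (trans (distribˡ v m′ 1#) (+-congˡ (*-identityʳ v)))) ⟩
      (v * m′ + v) * κ v u             ≈⟨ distribʳ (κ v u) (v * m′) v ⟩
      (v * m′) * κ v u + v * κ v u     ≈⟨ +-cong (sym (cancel-m′ v)) (*-comm v _) ⟩
      v / m + κ v u * v                ∎

  -- Finite sums, the Archimedean property and limits.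

  sum-cong : ∀ {n} {f g : Fin n → ℝ} → (∀ i → f i ≈ g i) → sum f ≈ sum g
  sum-cong {zero}  f≈g = refl
  sum-cong {suc n} f≈g = +-cong (f≈g zero) (sum-cong (f≈g ∘ suc))

  sum-mono : ∀ {n} {f g : Fin n → ℝ} → (∀ i → f i ≤ g i) → sum f ≤ sum g
  sum-mono {zero}  f≤g = ≤-refl
  sum-mono {suc n} f≤g = +-mono-≤ (f≤g zero) (sum-mono (f≤g ∘ suc))

  sum-zero : ∀ {n} {f : Fin n → ℝ} → (∀ i → f i ≈ 0#) → sum f ≈ 0#
  sum-zero {zero}  f≈0 = refl
  sum-zero {suc n} f≈0 = trans (+-cong (f≈0 zero) (sum-zero (f≈0 ∘ suc))) (+-identityˡ 0#)

  sum-nonneg : ∀ {n} {f : Fin n → ℝ} → (∀ i → 0# ≤ f i) → 0# ≤ sum f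
  sum-nonneg {zero}  0≤f = ≤-refl
  sum-nonneg {suc n} 0≤f = +-nonneg (0≤f zero) (sum-nonneg (0≤f ∘ suc))

  sum-single : ∀ {n} {f : Fin n → ℝ} i → (∀ j → j ≢ i → f j ≈ 0#) → sum f ≈ f i
  sum-single zero    f≈0 = trans (+-congˡ (sum-zero (λ j → f≈0 (suc j) λ ()))) (+-identityʳ _)
  sum-single (suc i) f≈0 = trans (+-cong (f≈0 zero λ ()) (sum-single i (λ j j≢i → f≈0 (suc j) λ { ≡.refl → j≢i ≡.refl }))) (+-identityˡ _)

  term≤sum : ∀ {n} {f : Fin n → ℝ} → (∀ i → 0# ≤ f i) → ∀ i → f i ≤ sum f
  term≤sum 0≤f zero    = x≤x+nonneg (sum-nonneg (0≤f ∘ suc))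
  term≤sum 0≤f (suc i) = ≤-trans (term≤sum (0≤f ∘ suc) i) (≤-trans (x≤x+nonneg (0≤f zero)) (≤-reflexive (+-comm _ _)))

  -- Bounded multiples would have a supremum `s`; as `n · d + d` is again a multiple, `s - d` is an
  -- upper bound too, which contradicts `0# < d`.
  archimedean : ∀ {x d} → 0# < d → ¬ (∀ n → n · d ≤ x)
  archimedean {x} {d} 0<d bounded with complete (λ y → ∃ λ n → y ≈ n · d) (0# , 0 , refl)
                                         (x , λ { (n , y≈nd) → ≤-trans (≤-reflexive y≈nd) (bounded n) })
  ... | s , isUpper , isLeast = 0<d (+-cancelʳ-≤ s (begin
    d + s       ≈⟨ +-comm d s ⟩
    s + d       ≤⟨ +-monoˡ-≤ d s≤s-d ⟩
    (s - d) + d ≈⟨ -+-cancel s d ⟩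
    s           ≈⟨ +-identityˡ s ⟨
    0# + s      ∎))
    where
    s≤s-d : s ≤ s - d
    s≤s-d = isLeast λ { (n , y≈nd) → x+z≤y⇒x≤y-z (≤-trans (+-monoˡ-≤ d (≤-reflexive y≈nd))
                          (≤-trans (≤-reflexive (+-comm _ d)) (isUpper (suc n , refl)))) }

  fromℕ-nonneg : ∀ n → 0# ≤ fromℕ n
  fromℕ-nonneg zero    = ≤-refl
  fromℕ-nonneg (suc n) = +-nonneg 0≤1 (fromℕ-nonneg n)

  fromℕ-suc-pos : ∀ n → 0# < fromℕ (suc n)
  fromℕ-suc-pos n = <-≤-trans 0<1 (x≤x+nonneg (fromℕ-nonneg n))

  ·-fromℕ : ∀ n x → n · x ≈ x * fromℕ n
  ·-fromℕ zero    x = sym (zeroʳ x)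
  ·-fromℕ (suc n) x = trans (+-cong (sym (*-identityʳ x)) (·-fromℕ n x)) (sym (distribˡ x 1# (fromℕ n)))

  -- Otherwise `x - y` is positive and all its multiples stay below `c`.
  limit-≤ : ∀ {x y c} → 0# ≤ c → (∀ n → x ≤ y + c / fromℕ (suc n)) → x ≤ y
  limit-≤ {x} {y} {c} 0≤c bound with x ≤? y
  ... | yes x≤y = x≤y
  ... | no  y<x = contradiction multiples (archimedean (λ x-y≤0 → y<x (≤-trans (x-z≤y⇒x≤y+z x-y≤0) (≤-reflexive (+-identityˡ y)))))
    where
    multiples : ∀ n → n · (x - y) ≤ c
    multiples zero    = 0≤c
    multiples (suc n) = begin
      suc n · (x - y)                      ≈⟨ ·-fromℕ (suc n) (x - y) ⟩
      (x - y) * fromℕ (suc n)              ≤⟨ *-monoˡ-≤ (fromℕ-nonneg (suc n)) (x≤y+z⇒x-z≤y (≤-trans (bound n) (≤-reflexive (+-comm _ _)))) ⟩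
      (c / fromℕ (suc n)) * fromℕ (suc n)  ≈⟨ /-*-cancel (fromℕ-suc-pos n) ⟩
      c                                    ∎

-- Finite operations and finite splittings in a σ-algebra.

module SigmaAlgebraProperties (em : ∀ {ℓ} → ExcludedMiddle ℓ) {Ω : Set} (𝓖 : SigmaAlgebra Ω) where
  open SigmaAlgebra 𝓖 hiding (Measurable)

  private
    Meas = Measurable 𝓖

  const-measurable : (Q : Set) → Meas (λ _ → Q)
  const-measurable Q with em {P = Q}
  ... | yes q = ≐-closed ((λ _ → q) , _) U-measurable
  ... | no ¬q = ≐-closed ((λ ¬u → contradiction tt ¬u) , λ q → contradiction q ¬q) (∁-measurable U-measurable)

  ∪-measurable : ∀ {B C} → Meas B → Meas C → Meas (B ∪ C)
  ∪-measurable {B} {C} mB mC = ≐-closed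
    ((λ { (zero , b) → inj₁ b ; (suc _ , c) → inj₂ c }) , λ { (inj₁ b) → 0 , b ; (inj₂ c) → 1 , c })
    (⋃-measurable {seq} λ { zero → mB ; (suc _) → mC })
    where
    seq : ℕ → Event Ω
    seq zero    = B
    seq (suc _) = C

  ∩-measurable : ∀ {B C} → Meas B → Meas C → Meas (B ∩ C)
  ∩-measurable {B} {C} mB mC = ≐-closed (to , λ { (b , c) (inj₁ ¬b) → ¬b b ; (b , c) (inj₂ ¬c) → ¬c c })
    (∁-measurable (∪-measurable (∁-measurable mB) (∁-measurable mC)))
    where
    to : ∁ (∁ B ∪ ∁ C) ⊆ B ∩ C
    to {ω} h with em {P = B ω} | em {P = C ω}
    ... | yes b | yes c = b , c
    ... | no ¬b | _     = contradiction (inj₁ ¬b) h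
    ... | _     | no ¬c = contradiction (inj₂ ¬c) h

  ⋃-Fin-measurable : ∀ {n} {B : Fin n → Event Ω} → (∀ i → Meas (B i)) → Meas (⋃ (Fin n) B)
  ⋃-Fin-measurable {zero}  mB = ≐-closed ((λ ()) , λ { (() , _) }) (const-measurable (Fin 0))
  ⋃-Fin-measurable {suc n} mB = ≐-closed
    ((λ { (inj₁ b) → zero , b ; (inj₂ (i , b)) → suc i , b }) , λ { (zero , b) → inj₁ b ; (suc i , b) → inj₂ (i , b) })
    (∪-measurable (mB zero) (⋃-Fin-measurable (mB ∘ suc)))

  ⋃-<-measurable : ∀ n {B : ℕ → Event Ω} → (∀ i → Meas (B i)) → Meas (λ ω → ∃ λ i → i ℕ.< n × B i ω)
  ⋃-<-measurable n {B} mB = ≐-closed ((λ { (i , i<n , b) → i , i<n , b }) , λ { (i , i<n , b) → i , i<n , b })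
    (⋃-measurable λ i → ∩-measurable (const-measurable (i ℕ.< n)) (mB i))

  -- Holds when every event in 𝓖 splits into finitely many events in 𝓖 with property K,
  -- phrased as the proof principle for additive Ψ that this yields.
  Attainable : ∀ {ℓ} ψ → (Event Ω → Set ℓ) → Set _
  Attainable ψ K = (Ψ : Event Ω → Set ψ) →
    (∀ {E G} → Meas E → Meas G → Ψ (G ∩ E) → Ψ (G ∩ ∁ E) → Ψ G) →
    (∀ {G} → Meas G → K G → Ψ G) → ∀ {G} → Meas G → Ψ G

  Hereditary : ∀ {ℓ} → (Event Ω → Set ℓ) → Set _
  Hereditary K = ∀ {G G′} → G′ ⊆ G → K G → K G′

  Decides : Event Ω → Event Ω → Set
  Decides E G = G ⊆ E ⊎ G ⊆ ∁ E

  Decides-hereditary : ∀ {E} → Hereditary (Decides E)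
  Decides-hereditary G′⊆G (inj₁ G⊆E)  = inj₁ (G⊆E ∘ G′⊆G)
  Decides-hereditary G′⊆G (inj₂ G⊆∁E) = inj₂ (G⊆∁E ∘ G′⊆G)

  Decides-constant : ∀ {E G ω ω′} → Decides E G → ω ∈ G → ω′ ∈ G → E ω → E ω′
  Decides-constant (inj₁ G⊆E)  _  g′ _ = G⊆E g′
  Decides-constant (inj₂ G⊆∁E) g  _  e = contradiction e (G⊆∁E g)

  attain-event : ∀ {ψ E} → Meas E → Attainable ψ (Decides E)
  attain-event mE Ψ split base mG = split mE mG
    (base (∩-measurable mG mE) (inj₁ proj₂)) (base (∩-measurable mG (∁-measurable mE)) (inj₂ proj₂))

  attain-⇒ : ∀ {ψ k k′} {K : Event Ω → Set k} {K′ : Event Ω → Set k′} →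
             (∀ {G} → Meas G → K G → K′ G) → Attainable ψ K → Attainable ψ K′
  attain-⇒ K⇒K′ att Ψ split base = att Ψ split λ mG → base mG ∘ K⇒K′ mG

  -- Every piece of the first splitting is split again. The motive `H ⊆ G → Ψ H` remembers that the
  -- finer pieces stay inside a piece with `K`, and heredity carries `K` down to them.
  attain-× : ∀ {ψ k k′} {K : Event Ω → Set k} {K′ : Event Ω → Set k′} → Hereditary K →
             Attainable ψ K → Attainable ψ K′ → Attainable ψ (λ G → K G × K′ G)
  attain-× hered att att′ Ψ split base = att Ψ split λ {G} mG kG →
    att′ (λ H → H ⊆ G → Ψ H)
         (λ mE mH p q H⊆G → split mE mH (p (H⊆G ∘ proj₁)) (q (H⊆G ∘ proj₁)))
         (λ mH k′H H⊆G → base mH (hered H⊆G kG , k′H)) mG id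

  attain-∀ : ∀ {ψ n k} {K : Fin n → Event Ω → Set k} → (∀ i → Hereditary (K i)) →
             (∀ i → Attainable ψ (K i)) → Attainable ψ (λ G → ∀ i → K i G)
  attain-∀ {n = zero}  hered att Ψ split base mG = base mG λ ()
  attain-∀ {n = suc n} hered att = attain-⇒ (λ { _ (k , ks) zero → k ; _ (k , ks) (suc i) → ks i })
    (attain-× (hered zero) (att zero) (attain-∀ (hered ∘ suc) (att ∘ suc)))

-- Indicators and the additivity of probability.

module Measure (em : ∀ {ℓ} → ExcludedMiddle ℓ) (R : RealNumbers) {Ω : Set}
               (prob : Probability.ProbabilitySpace R Ω) where
  open RealNumbers R hiding (zero)
  open RealProperties R
  open Probability R
  open ProbabilitySpace prob
  open SigmaAlgebraProperties em 𝓕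
  open SigmaAlgebra 𝓕 using (≐-closed; U-measurable; ∁-measurable; ⋃-measurable)
  open PosetReasoning poset
  open CommutativeSemigroupProperties +-commutativeSemigroup using (interchange)
  open Max totalOrder using (maxOperator)
  open MaxOp maxOperator using (x≤x⊔y; ⊔-lub; ⊔-monoˡ-≤)

  private
    Meas = Measurable 𝓕

  ind : Set → ℝ
  ind Q = if does (em {P = Q}) then 1# else 0#

  ind-yes : ∀ {Q} → Q → ind Q ≡ 1#
  ind-yes {Q} q with em {P = Q}
  ... | yes _ = ≡.refl
  ... | no ¬q = contradiction q ¬q

  ind-no : ∀ {Q} → ¬ Q → ind Q ≡ 0#
  ind-no {Q} ¬q with em {P = Q}
  ... | yes q = contradiction q ¬q
  ... | no _  = ≡.refl

  ind-nonneg : ∀ Q → 0# ≤ ind Q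
  ind-nonneg Q with em {P = Q}
  ... | yes _ = 0≤1
  ... | no _  = ≤-refl

  ind≤1 : ∀ Q → ind Q ≤ 1#
  ind≤1 Q with em {P = Q}
  ... | yes _ = ≤-refl
  ... | no _  = 0≤1

  ind-mono : ∀ {Q Q′} → (Q → Q′) → ind Q ≤ ind Q′
  ind-mono {Q} {Q′} f with em {P = Q}
  ... | yes q = ≤-reflexive (sym (reflexive (ind-yes (f q))))
  ... | no _  = ind-nonneg Q′

  ind-cong : ∀ {Q Q′} → (Q → Q′) → (Q′ → Q) → ind Q ≈ ind Q′
  ind-cong f g = ≤-antisym (ind-mono f) (ind-mono g)

  -- The constant sequence `B`, `B`, ... is pairwise disjoint because `B` is empty, and its union is
  -- `B`; two terms of the series already give `P B + P B ≤ P B`.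
  P-∅ : ∀ {B} → Meas B → Empty B → P B ≈ 0#
  P-∅ {B} mB empty = ≤-antisym (+-cancelʳ-≤ (P B) (begin
    P B + P B              ≈⟨ +-congˡ (+-identityʳ (P B)) ⟨
    P B + (P B + 0#)       ≤⟨ proj₁ (P-additive (λ _ → mB) (λ _ ω (b , _) → empty ω b)) (2 , refl) ⟩
    P (⋃ ℕ λ _ → B)        ≈⟨ P-cong mB ((λ b → 0 , b) , proj₂) ⟨
    P B                    ≈⟨ +-identityˡ (P B) ⟨
    0# + P B               ∎)) (P-nonneg mB)

  P-additive₂ : ∀ {B C} → Meas B → Meas C → Empty (B ∩ C) → P (B ∪ C) ≈ P B + P C
  P-additive₂ {B} {C} mB mC disjoint = trans (P-cong (∪-measurable mB mC) (to , from)) (≤-antisym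
    (proj₂ sup λ { (n , x≈) → ≤-trans (≤-reflexive x≈) (partial n) })
    (proj₁ sup (2 , +-congˡ (sym (+-identityʳ (P C))))))
    where
    m∅ = const-measurable (Fin 0)

    seq : ℕ → Event Ω
    seq 0             = B
    seq 1             = C
    seq (suc (suc _)) = λ _ → Fin 0

    seq-measurable : ∀ n → Meas (seq n)
    seq-measurable 0             = mB
    seq-measurable 1             = mC
    seq-measurable (suc (suc _)) = m∅

    seq-disjoint : PairwiseDisjoint seq
    seq-disjoint {0}           {0}           i≢j = contradiction ≡.refl i≢j
    seq-disjoint {0}           {1}           i≢j = disjoint
    seq-disjoint {1}           {0}           i≢j = λ { ω (c , b) → disjoint ω (b , c) }
    seq-disjoint {1}           {1}           i≢j = contradiction ≡.refl i≢j
    seq-disjoint {suc (suc _)} {_}           i≢j = λ { _ (() , _) }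
    seq-disjoint {0}           {suc (suc _)} i≢j = λ { _ (_ , ()) }
    seq-disjoint {1}           {suc (suc _)} i≢j = λ { _ (_ , ()) }

    sup = P-additive seq-measurable seq-disjoint

    to : B ∪ C ⊆ ⋃ ℕ seq
    to (inj₁ b) = 0 , b
    to (inj₂ c) = 1 , c

    from : ⋃ ℕ seq ⊆ B ∪ C
    from (0 , b)            = inj₁ b
    from (1 , c)            = inj₂ c
    from (suc (suc _) , ())

    partial : ∀ n → sum {n} (λ i → P (seq (toℕ i))) ≤ P B + P C
    partial 0 = +-nonneg (P-nonneg mB) (P-nonneg mC)
    partial 1 = +-monoʳ-≤ (P B) (P-nonneg mC)
    partial (suc (suc n)) = +-monoʳ-≤ (P B) (≤-reflexive (trans
      (+-congˡ (sum-zero {n} λ _ → P-∅ m∅ λ _ ())) (+-identityʳ (P C))))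

  P-split : ∀ {G E} → Meas G → Meas E → P G ≈ P (G ∩ E) + P (G ∩ ∁ E)
  P-split {G} {E} mG mE = trans (P-cong mG (to , λ { (inj₁ (g , _)) → g ; (inj₂ (g , _)) → g }))
    (P-additive₂ (∩-measurable mG mE) (∩-measurable mG (∁-measurable mE)) λ { _ ((_ , e) , (_ , ¬e)) → ¬e e })
    where
    to : G ⊆ (G ∩ E) ∪ (G ∩ ∁ E)
    to {ω} g with em {P = E ω}
    ... | yes e = inj₁ (g , e)
    ... | no ¬e = inj₂ (g , ¬e)

  P-mono : ∀ {B C} → Meas B → Meas C → B ⊆ C → P B ≤ P C
  P-mono {B} {C} mB mC B⊆C = begin
    P B                      ≈⟨ P-cong mB ((λ b → B⊆C b , b) , proj₂) ⟩
    P (C ∩ B)                ≤⟨ x≤x+nonneg (P-nonneg (∩-measurable mC (∁-measurable mB))) ⟩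
    P (C ∩ B) + P (C ∩ ∁ B)  ≈⟨ P-split mC mB ⟨
    P C                      ∎

  -- Additivity speaks of disjoint events, so `B n` is cut down to the outcomes that no earlier
  -- event contains. All partial sums are then 0, and the union is unchanged because every outcome
  -- in it has a least index.
  null-⋃ : {B : ℕ → Event Ω} → (∀ n → Meas (B n)) → (∀ n → P (B n) ≈ 0#) → P (⋃ ℕ B) ≈ 0#
  null-⋃ {B} mB null = ≤-antisym
    (≤-trans (≤-reflexive (P-cong (⋃-measurable mB) ((λ { (n , b) → first n b }) , λ { (n , b , _) → n , b })))
      (proj₂ (P-additive mB′ disjoint) λ { (n , x≈) → ≤-reflexive (trans x≈ (sum-zero {n} λ i → null′ (toℕ i))) }))
    (P-nonneg (⋃-measurable mB))
    where
    Earlier : ℕ → Event Ω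
    Earlier n ω = ∃ λ i → i ℕ.< n × B i ω

    B′ : ℕ → Event Ω
    B′ n = B n ∩ ∁ (Earlier n)

    mB′ : ∀ n → Meas (B′ n)
    mB′ n = ∩-measurable (mB n) (∁-measurable (⋃-<-measurable n mB))

    null′ : ∀ n → P (B′ n) ≈ 0#
    null′ n = ≤-antisym (≤-trans (P-mono (mB′ n) (mB n) proj₁) (≤-reflexive (null n))) (P-nonneg (mB′ n))

    disjoint : PairwiseDisjoint B′
    disjoint {i} {j} i≢j ω ((bi , ¬i) , (bj , ¬j)) with ℕ.<-cmp i j
    ... | tri< i<j _ _ = ¬j (i , i<j , bi)
    ... | tri≈ _ i≡j _ = i≢j i≡j
    ... | tri> _ _ j<i = ¬i (j , j<i , bj)

    first : ∀ {ω} n → B n ω → (⋃ ℕ B′) ω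
    first {ω} = <-rec _ λ n rec b → minimal n rec b em
      where
      minimal : ∀ n → (∀ {i} → i ℕ.< n → B i ω → (⋃ ℕ B′) ω) → B n ω → Dec (Earlier n ω) → (⋃ ℕ B′) ω
      minimal n rec b (yes (i , i<n , bi)) = rec i<n bi
      minimal n rec b (no ¬earlier)        = n , b , ¬earlier

  -- Simple functions and their expectations.

  infixl 6 _⊕_
  infixl 7 _⊛_

  -- Syntax instead of functions: the expectation over an event is computed by recursion, so it is
  -- linear by definition and finite from the start. Only `branch` mentions events, and it carries
  -- their measurability.
  data Simple : Set₁ where
    const  : ℝ → Simple
    _⊕_    : Simple → Simple → Simple
    _⊛_    : ℝ → Simple → Simple
    branch : (E : Event Ω) → Meas E → Simple → Simple → Simple

  ⟦_⟧ : Simple → Ω → ℝ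
  ⟦ const a ⟧         ω = a
  ⟦ s ⊕ t ⟧           ω = ⟦ s ⟧ ω + ⟦ t ⟧ ω
  ⟦ a ⊛ s ⟧           ω = a * ⟦ s ⟧ ω
  ⟦ branch E _ s t ⟧  ω = if does (em {P = E ω}) then ⟦ s ⟧ ω else ⟦ t ⟧ ω

  𝔼 : Simple → Event Ω → ℝ
  𝔼 (const a)        G = a * P G
  𝔼 (s ⊕ t)          G = 𝔼 s G + 𝔼 t G
  𝔼 (a ⊛ s)          G = a * 𝔼 s G
  𝔼 (branch E _ s t) G = 𝔼 s (G ∩ E) + 𝔼 t (G ∩ ∁ E)

  𝔼-cong : ∀ s {G H} → Meas G → G ≐ H → 𝔼 s G ≈ 𝔼 s H
  𝔼-cong (const a) mG G≐H = *-congˡ (P-cong mG G≐H)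
  𝔼-cong (s ⊕ t)   mG G≐H = +-cong (𝔼-cong s mG G≐H) (𝔼-cong t mG G≐H)
  𝔼-cong (a ⊛ s)   mG G≐H = *-congˡ (𝔼-cong s mG G≐H)
  𝔼-cong (branch E mE s t) mG (G⊆H , H⊆G) = +-cong
    (𝔼-cong s (∩-measurable mG mE) ((λ (g , e) → G⊆H g , e) , λ (h , e) → H⊆G h , e))
    (𝔼-cong t (∩-measurable mG (∁-measurable mE)) ((λ (g , e) → G⊆H g , e) , λ (h , e) → H⊆G h , e))

  𝔼-∅ : ∀ s {G} → Meas G → Empty G → 𝔼 s G ≈ 0#
  𝔼-∅ (const a) mG empty = trans (*-congˡ (P-∅ mG empty)) (zeroʳ a)
  𝔼-∅ (s ⊕ t)   mG empty = trans (+-cong (𝔼-∅ s mG empty) (𝔼-∅ t mG empty)) (+-identityʳ 0#)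
  𝔼-∅ (a ⊛ s)   mG empty = trans (*-congˡ (𝔼-∅ s mG empty)) (zeroʳ a)
  𝔼-∅ (branch E mE s t) mG empty = trans (+-cong
    (𝔼-∅ s (∩-measurable mG mE) λ ω (g , _) → empty ω g)
    (𝔼-∅ t (∩-measurable mG (∁-measurable mE)) λ ω (g , _) → empty ω g)) (+-identityʳ 0#)

  𝔼-split : ∀ s {G E} → Meas G → Meas E → 𝔼 s G ≈ 𝔼 s (G ∩ E) + 𝔼 s (G ∩ ∁ E)
  𝔼-split (const a) mG mE = trans (*-congˡ (P-split mG mE)) (distribˡ a _ _)
  𝔼-split (s ⊕ t)   mG mE = trans (+-cong (𝔼-split s mG mE) (𝔼-split t mG mE)) (interchange _ _ _ _)
  𝔼-split (a ⊛ s)   mG mE = trans (*-congˡ (𝔼-split s mG mE)) (distribˡ a _ _)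
  𝔼-split (branch B mB s t) {G} {E} mG mE = trans (+-cong
    (trans (𝔼-split s (∩-measurable mG mB) mE)
      (+-cong (swap s mB mE) (swap s mB (∁-measurable mE))))
    (trans (𝔼-split t (∩-measurable mG (∁-measurable mB)) mE)
      (+-cong (swap t (∁-measurable mB) mE) (swap t (∁-measurable mB) (∁-measurable mE)))))
    (interchange _ _ _ _)
    where
    swap : ∀ s {B E} → Meas B → Meas E → 𝔼 s ((G ∩ B) ∩ E) ≈ 𝔼 s ((G ∩ E) ∩ B)
    swap s mB mE = 𝔼-cong s (∩-measurable (∩-measurable mG mB) mE)
      ((λ ((g , b) , e) → (g , e) , b) , λ ((g , e) , b) → (g , b) , e)

  -- Constancy is expressed by its effect on `𝔼`, which is what comparisons use; on null events the
  -- values may still differ. Quantifying over all measurable `H ⊆ G` makes the property hereditary.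
  ConstantOn : Simple → Event Ω → Set₁
  ConstantOn s G = ∀ {H} → Meas H → H ⊆ G → ∀ {ω} → ω ∈ H → 𝔼 s H ≈ ⟦ s ⟧ ω * P H

  ConstantOn-hereditary : ∀ s → Hereditary (ConstantOn s)
  ConstantOn-hereditary s H⊆G cs mI I⊆H = cs mI (H⊆G ∘ I⊆H)

  attain-constant : ∀ s → Attainable 0ℓ (ConstantOn s)
  attain-constant (const a) Ψ split base mG = base mG λ _ _ _ → refl
  attain-constant (s ⊕ t) = attain-⇒ {K′ = ConstantOn (s ⊕ t)}
    (λ _ (cs , ct) mH H⊆G h → trans (+-cong (cs mH H⊆G h) (ct mH H⊆G h)) (sym (distribʳ _ _ _)))
    (attain-× (ConstantOn-hereditary s) (attain-constant s) (attain-constant t))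
  attain-constant (a ⊛ s) = attain-⇒ {K = ConstantOn s} {K′ = ConstantOn (a ⊛ s)}
    (λ _ cs mH H⊆G h → trans (*-congˡ (cs mH H⊆G h)) (sym (*-assoc _ _ _)))
    (attain-constant s)
  attain-constant (branch E mE s t) = attain-⇒ {K′ = ConstantOn (branch E mE s t)} combine
    (attain-× Decides-hereditary (attain-event mE)
      (attain-× (ConstantOn-hereditary s) (attain-constant s) (attain-constant t)))
    where
    combine : ∀ {G} → Meas G → Decides E G × ConstantOn s G × ConstantOn t G → ConstantOn (branch E mE s t) G
    combine mG (inj₁ G⊆E , cs , _) {H} mH H⊆G {ω} h with em {P = E ω}
    ... | no ¬e = contradiction (G⊆E (H⊆G h)) ¬e
    ... | yes _ = begin-equality
      𝔼 s (H ∩ E) + 𝔼 t (H ∩ ∁ E)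
        ≈⟨ +-cong (𝔼-cong s mH ((λ h′ → h′ , G⊆E (H⊆G h′)) , proj₁))
                  (sym (𝔼-∅ t (∩-measurable mH (∁-measurable mE)) λ _ (h′ , ¬e) → ¬e (G⊆E (H⊆G h′)))) ⟨
      𝔼 s H + 0#      ≈⟨ +-identityʳ _ ⟩
      𝔼 s H           ≈⟨ cs mH H⊆G h ⟩
      ⟦ s ⟧ ω * P H   ∎
    combine mG (inj₂ G⊆∁E , _ , ct) {H} mH H⊆G {ω} h with em {P = E ω}
    ... | yes e = contradiction e (G⊆∁E (H⊆G h))
    ... | no _ = begin-equality
      𝔼 s (H ∩ E) + 𝔼 t (H ∩ ∁ E)
        ≈⟨ +-cong (sym (𝔼-∅ s (∩-measurable mH mE) λ _ (h′ , e) → G⊆∁E (H⊆G h′) e))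
                  (𝔼-cong t mH ((λ h′ → h′ , G⊆∁E (H⊆G h′)) , proj₁)) ⟨
      0# + 𝔼 t H      ≈⟨ +-identityˡ _ ⟩
      𝔼 t H           ≈⟨ ct mH H⊆G h ⟩
      ⟦ t ⟧ ω * P H   ∎

  -- The two expressions may branch on unrelated events, so a recursion on either one would not
  -- match the other. On a common splitting both expectations become value times probability; an
  -- empty piece has no value to compare and gives 0 twice.
  𝔼-mono : ∀ s t {G} → Meas G → (∀ {ω} → ω ∈ G → ⟦ s ⟧ ω ≤ ⟦ t ⟧ ω) → 𝔼 s G ≤ 𝔼 t G
  𝔼-mono s t = attain-× (ConstantOn-hereditary s) (attain-constant s) (attain-constant t)
    (λ G → (∀ {ω} → ω ∈ G → ⟦ s ⟧ ω ≤ ⟦ t ⟧ ω) → 𝔼 s G ≤ 𝔼 t G)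
    (λ mE mG p q s≤t → ≤-trans (≤-reflexive (𝔼-split s mG mE))
      (≤-trans (+-mono-≤ (p (s≤t ∘ proj₁)) (q (s≤t ∘ proj₁))) (≤-reflexive (sym (𝔼-split t mG mE)))))
    (λ {G} mG (cs , ct) s≤t → atom mG cs ct s≤t em)
    where
    atom : ∀ {G} → Meas G → ConstantOn s G → ConstantOn t G →
           (∀ {ω} → ω ∈ G → ⟦ s ⟧ ω ≤ ⟦ t ⟧ ω) → Dec (Satisfiable G) → 𝔼 s G ≤ 𝔼 t G
    atom {G} mG cs ct s≤t (yes (ω , g)) = begin
      𝔼 s G           ≈⟨ cs mG id g ⟩
      ⟦ s ⟧ ω * P G   ≤⟨ *-monoˡ-≤ (P-nonneg mG) (s≤t g) ⟩
      ⟦ t ⟧ ω * P G   ≈⟨ ct mG id g ⟨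
      𝔼 t G           ∎
    atom mG cs ct s≤t (no empty) = ≤-reflexive (trans (𝔼-∅ s mG λ ω g → empty (ω , g)) (sym (𝔼-∅ t mG λ ω g → empty (ω , g))))

  indicator : (E : Event Ω) → Meas E → Simple
  indicator E mE = branch E mE (const 1#) (const 0#)

  𝔼-indicator : ∀ {E G} (mE : Meas E) → 𝔼 (indicator E mE) G ≈ P (G ∩ E)
  𝔼-indicator mE = trans (+-cong (*-identityˡ _) (zeroˡ _)) (+-identityʳ _)

  ∑ : ∀ {n} → (Fin n → Simple) → Simple
  ∑ {zero}  s = const 0#
  ∑ {suc n} s = s zero ⊕ ∑ (s ∘ suc)

  ⟦∑⟧ : ∀ {n} (s : Fin n → Simple) ω → ⟦ ∑ s ⟧ ω ≡ sum (λ i → ⟦ s i ⟧ ω)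
  ⟦∑⟧ {zero}  s ω = ≡.refl
  ⟦∑⟧ {suc n} s ω = ≡.cong (⟦ s zero ⟧ ω +_) (⟦∑⟧ (s ∘ suc) ω)

  𝔼-∑ : ∀ {n} (s : Fin n → Simple) G → 𝔼 (∑ s) G ≈ sum (λ i → 𝔼 (s i) G)
  𝔼-∑ {zero}  s G = zeroˡ (P G)
  𝔼-∑ {suc n} s G = +-congˡ (𝔼-∑ (s ∘ suc) G)

  -- Branches on the events one after another and hands the number of those that occur to `f`, which
  -- allows nonlinear functions of counts. The idle `0# +` matches the unfolding of the sum of
  -- indicators, so that `⟦tally⟧` is a propositional equality.
  tally : ∀ {n} (E : Fin n → Event Ω) → (∀ i → Meas (E i)) → (ℝ → Simple) → Simple
  tally {zero}  E mE f = f 0#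
  tally {suc n} E mE f = branch (E zero) (mE zero)
    (tally (E ∘ suc) (mE ∘ suc) (λ x → f (1# + x))) (tally (E ∘ suc) (mE ∘ suc) (λ x → f (0# + x)))

  ⟦tally⟧ : ∀ {n} (E : Fin n → Event Ω) (mE : ∀ i → Meas (E i)) f ω →
            ⟦ tally E mE f ⟧ ω ≡ ⟦ f (sum (λ i → ind (E i ω))) ⟧ ω
  ⟦tally⟧ {zero}  E mE f ω = ≡.refl
  ⟦tally⟧ {suc n} E mE f ω with em {P = E zero ω}
  ... | yes _ = ⟦tally⟧ (E ∘ suc) (mE ∘ suc) (λ x → f (1# + x)) ω
  ... | no _  = ⟦tally⟧ (E ∘ suc) (mE ∘ suc) (λ x → f (0# + x)) ω

  -- Peels `B zero` off `G` and continues in the rest, where the other events lie; nonnegativity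
  -- pays for what remains uncovered.
  𝔼-disjoint : ∀ s {n G} {B : Fin n → Event Ω} → Meas G → (∀ i → Meas (B i)) → PairwiseDisjoint B →
               (∀ i → B i ⊆ G) → (∀ {ω} → ω ∈ G → 0# ≤ ⟦ s ⟧ ω) → sum (λ i → 𝔼 s (B i)) ≤ 𝔼 s G
  𝔼-disjoint s {zero}  {G} mG mB disj B⊆G 0≤s = ≤-trans (≤-reflexive (sym (zeroˡ (P G)))) (𝔼-mono (const 0#) s mG 0≤s)
  𝔼-disjoint s {suc n} {G} {B} mG mB disj B⊆G 0≤s = begin
    𝔼 s (B zero) + sum (λ i → 𝔼 s (B (suc i)))
      ≤⟨ +-mono-≤ (≤-reflexive (𝔼-cong s (mB zero) ((λ b → B⊆G zero b , b) , proj₂)))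
           (𝔼-disjoint s (∩-measurable mG (∁-measurable (mB zero))) (mB ∘ suc)
             (λ i≢j → disj (λ { ≡.refl → i≢j ≡.refl }))
             (λ i b → B⊆G (suc i) b , λ b₀ → disj (λ ()) _ (b₀ , b)) (0≤s ∘ proj₁)) ⟩
    𝔼 s (G ∩ B zero) + 𝔼 s (G ∩ ∁ (B zero))
      ≈⟨ 𝔼-split s mG (mB zero) ⟨
    𝔼 s G ∎

  -- Lebesgue integrals compared with simple functions.

  IsIntegral⁺-mono : ∀ {f g G a b} → (∀ {ω} → ω ∈ G → f ω ≤ g ω) →
                     IsIntegral⁺ prob f G a → IsIntegral⁺ prob g G b → a ≤ b
  IsIntegral⁺-mono f≤g (_ , least) (upper , _) = least λ (n , c , B , mB , disj , B⊆G , 0≤c , c≤f , x≈) →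
    upper (n , c , B , mB , disj , B⊆G , 0≤c , (λ i b → ≤-trans (c≤f i b) (f≤g (B⊆G i b))) , x≈)

  IsIntegral⁺-nonneg : ∀ {f G a} → IsIntegral⁺ prob f G a → 0# ≤ a
  IsIntegral⁺-nonneg (upper , _) = upper (0 , (λ ()) , (λ ()) , (λ ()) , (λ { {()} }) , (λ ()) , (λ ()) , (λ ()) , refl)

  -- Every simple function competing in the supremum lies below `s` on each of its pieces, and these
  -- are disjoint subsets of `G`.
  IsIntegral⁺-≤ : ∀ s {f G a} → Meas G → (∀ {ω} → ω ∈ G → 0# ≤ ⟦ s ⟧ ω) →
                  (∀ {ω} → ω ∈ G → f ω ≤ ⟦ s ⟧ ω) → IsIntegral⁺ prob f G a → a ≤ 𝔼 s G
  IsIntegral⁺-≤ s mG 0≤s f≤s (_ , least) = least λ (n , c , B , mB , disj , B⊆G , 0≤c , c≤f , x≈) →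
    ≤-trans (≤-reflexive x≈) (≤-trans
      (sum-mono λ i → 𝔼-mono (const (c i)) s (mB i) λ b → ≤-trans (c≤f i b) (f≤s (B⊆G i b)))
      (𝔼-disjoint s mG mB disj B⊆G 0≤s))

  IsIntegral-mono : ∀ {f g G a b} → (∀ {ω} → ω ∈ G → f ω ≤ g ω) →
                    IsIntegral prob f G a → IsIntegral prob g G b → a ≤ b
  IsIntegral-mono f≤g (a⁺ , a⁻ , fa⁺ , fa⁻ , a≈) (b⁺ , b⁻ , gb⁺ , gb⁻ , b≈) =
    ≤-trans (≤-reflexive a≈) (≤-trans
      (+-mono-≤ (IsIntegral⁺-mono (λ g → ⊔-monoˡ-≤ 0# (f≤g g)) fa⁺ gb⁺)
                (neg-mono-≤ (IsIntegral⁺-mono (λ g → ⊔-monoˡ-≤ 0# (neg-mono-≤ (f≤g g))) gb⁻ fa⁻)))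
      (≤-reflexive (sym b≈)))

  IsIntegral-≤ : ∀ s {f G a} → Meas G → (∀ {ω} → ω ∈ G → 0# ≤ ⟦ s ⟧ ω) →
                 (∀ {ω} → ω ∈ G → f ω ≤ ⟦ s ⟧ ω) → IsIntegral prob f G a → a ≤ 𝔼 s G
  IsIntegral-≤ s {f} {G} {a} mG 0≤s f≤s (a⁺ , a⁻ , fa⁺ , fa⁻ , a≈) = begin
    a           ≈⟨ a≈ ⟩
    a⁺ - a⁻     ≤⟨ x≤y+z⇒x-z≤y (x≤x+nonneg (IsIntegral⁺-nonneg fa⁻)) ⟩
    a⁺          ≤⟨ IsIntegral⁺-≤ s mG 0≤s (λ g → ⊔-lub (f≤s g) (0≤s g)) fa⁺ ⟩
    𝔼 s G       ∎

  -- The one-piece function with value `c` on `G` competes in the supremum for the positive part,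
  -- and the negative part of `f` vanishes on `G`.
  IsIntegral-≥ : ∀ {c f G a} → Meas G → 0# ≤ c → (∀ {ω} → ω ∈ G → c ≤ f ω) → IsIntegral prob f G a → c * P G ≤ a
  IsIntegral-≥ {c} {f} {G} {a} mG 0≤c c≤f (a⁺ , a⁻ , fa⁺ , fa⁻ , a≈) = begin
    c * P G     ≤⟨ proj₁ fa⁺ (1 , (λ _ → c) , (λ _ → G) , (λ _ → mG) , (λ { {zero} {zero} i≢j → contradiction ≡.refl i≢j })
                     , (λ _ → id) , (λ _ → 0≤c) , (λ _ g → ≤-trans (c≤f g) (x≤x⊔y _ 0#)) , sym (+-identityʳ _)) ⟩
    a⁺          ≤⟨ x+z≤y⇒x≤y-z (≤-trans (+-monoʳ-≤ a⁺ a⁻≤0) (≤-reflexive (+-identityʳ a⁺))) ⟩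
    a⁺ - a⁻     ≈⟨ a≈ ⟨
    a           ∎
    where
    a⁻≤0 : a⁻ ≤ 0#
    a⁻≤0 = ≤-trans (IsIntegral⁺-≤ (const 0#) mG (λ _ → ≤-refl)
        (λ g → ⊔-lub (≤-trans (neg-mono-≤ (≤-trans 0≤c (c≤f g))) (≤-reflexive -0#≈0#)) ≤-refl) fa⁻)
      (≤-reflexive (zeroˡ (P G)))

x∈p─q⇒x∉q : ∀ {n} (p q : Subset n) {x} → x Subset.∈ p Subset.─ q → ¬ x Subset.∈ q
x∈p─q⇒x∉q (_ ∷ p) (outside ∷ q) (there x∈p─q) (there x∈q) = x∈p─q⇒x∉q p q x∈p─q x∈q
x∈p─q⇒x∉q (_ ∷ p) (inside  ∷ q) (there x∈p─q) (there x∈q) = x∈p─q⇒x∉q p q x∈p─q x∈q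

-- The sampling game: counting elements.

module SamplingGame
  (em : ∀ {ℓ} → ExcludedMiddle ℓ) (R : RealNumbers) {Ω : Set}
  (prob : Probability.ProbabilitySpace R Ω) {β : RealNumbers.ℝ R}
  (1≤β : RealNumbers._≤_ R (RealNumbers.1# R) β)
  {m : ℕ} {w₀ : Fin m → RealNumbers.ℝ R}
  (0≤w₀ : ∀ A → RealNumbers._≤_ R (RealNumbers.0# R) (w₀ A))
  (play : Game.Play R Ω m) (game : Game.IsSamplingGame R prob β w₀ play) where

  open RealNumbers R hiding (zero)
  open RealProperties R
  open Probability R
  open ProbabilitySpace prob
  open Measure em R prob
  open Game R
  open Play play
  open IsSamplingGame game
  open PosetReasoning poset
  open SumProperties semiring using (∑-distrib-+; *-distribˡ-sum; *-distribʳ-sum; ∑-comm)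
  open SemiringSolver commutativeSemiring using (solve; _:=_; _:+_; _:*_)

  0<β : 0# < β
  0<β = <-≤-trans 0<1 1≤β

  0≤β : 0# ≤ β
  0≤β = <⇒≤ 0<β

  count : (Fin m → Set) → ℝ
  count E = sum (λ A → ind (E A))

  count-nonneg : ∀ E → 0# ≤ count E
  count-nonneg E = sum-nonneg (λ A → ind-nonneg (E A))

  count-mono : ∀ {E E′} → (∀ A → E A → E′ A) → count E ≤ count E′
  count-mono E⊆E′ = sum-mono λ A → ind-mono (E⊆E′ A)

  count-empty : ∀ {E} → (∀ A → ¬ E A) → count E ≈ 0#
  count-empty empty = sum-zero λ A → reflexive (ind-no (empty A))

  count-inhabited : ∀ {E} A → E A → 1# ≤ count E
  count-inhabited {E} A e = ≤-trans (≤-reflexive (sym (reflexive (ind-yes e)))) (term≤sum (λ A → ind-nonneg (E A)) A)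

  private
    count-≡ : ∀ A → count (_≡ A) ≈ 1#
    count-≡ A = trans (sum-single A λ B B≢A → reflexive (ind-no B≢A)) (reflexive (ind-yes ≡.refl))

  count-remove-≤ : ∀ {E E′} A → E A → (∀ B → E′ B → E B × B ≢ A) → count E′ ≤ count E - 1#
  count-remove-≤ {E} {E′} A e E′⊆E = x+z≤y⇒x≤y-z (begin
    count E′ + 1#                               ≈⟨ +-congˡ (count-≡ A) ⟨
    count E′ + count (_≡ A)                     ≈⟨ ∑-distrib-+ (λ B → ind (E′ B)) (λ B → ind (B ≡ A)) ⟨
    sum (λ B → ind (E′ B) + ind (B ≡ A))        ≤⟨ sum-mono (λ B → termwise B (B ≟ A)) ⟩
    count E                                     ∎)
    where
    termwise : ∀ B → Dec (B ≡ A) → ind (E′ B) + ind (B ≡ A) ≤ ind (E B)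
    termwise B (yes ≡.refl) = ≤-reflexive (trans
      (+-cong (reflexive (ind-no λ e′ → proj₂ (E′⊆E B e′) ≡.refl)) (reflexive (ind-yes ≡.refl)))
      (trans (+-identityˡ 1#) (sym (reflexive (ind-yes e)))))
    termwise B (no B≢A) = ≤-trans (≤-reflexive (trans (+-congˡ (reflexive (ind-no B≢A))) (+-identityʳ _)))
      (ind-mono (proj₁ ∘ E′⊆E B))

  count-remove-≥ : ∀ {E E′} A → (∀ B → E B → B ≢ A → E′ B) → count E - 1# ≤ count E′
  count-remove-≥ {E} {E′} A E⊆E′ = x≤y+z⇒x-z≤y (begin
    count E                                     ≤⟨ sum-mono (λ B → termwise B (B ≟ A)) ⟩
    sum (λ B → ind (E′ B) + ind (B ≡ A))        ≈⟨ ∑-distrib-+ (λ B → ind (E′ B)) (λ B → ind (B ≡ A)) ⟩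
    count E′ + count (_≡ A)                     ≈⟨ +-congˡ (count-≡ A) ⟩
    count E′ + 1#                               ∎)
    where
    termwise : ∀ B → Dec (B ≡ A) → ind (E B) ≤ ind (E′ B) + ind (B ≡ A)
    termwise B (yes ≡.refl) = begin
      ind (E B)                ≤⟨ ind-mono {Q′ = B ≡ B} (λ _ → ≡.refl) ⟩
      ind (B ≡ B)              ≈⟨ +-identityˡ _ ⟨
      0# + ind (B ≡ B)         ≤⟨ +-monoˡ-≤ _ (ind-nonneg _) ⟩
      ind (E′ B) + ind (B ≡ B) ∎
    termwise B (no B≢A) = ≤-trans (ind-mono (λ e → E⊆E′ B e B≢A)) (x≤x+nonneg (ind-nonneg _))

  -- Stopping and positivity of weights.

  Live-pred : ∀ {j} → Live (suc j) ⊆ Live j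
  Live-pred live (i , i<1+j , t) = live (i , ℕ.m<n⇒m<1+n i<1+j , t)

  Live⇒¬Terminal : ∀ {j} → Live j ⊆ ∁ (Terminal j)
  Live⇒¬Terminal live t = live (_ , ℕ.≤-refl , t)

  -- State `j` exists and its sets and weights are meaningful: the round producing it was played. It
  -- may be terminal itself, which `Live j` excludes. This is also the guard on the history
  -- generators for state `j`; the initial state has none.
  PreLive : ℕ → Event Ω
  PreLive zero    = U
  PreLive (suc j) = Live j

  Live⇒PreLive : ∀ j → Live j ⊆ PreLive j
  Live⇒PreLive zero    _    = tt
  Live⇒PreLive (suc j) live = Live-pred live

  PreLive∧¬Terminal⇒Live : ∀ j {ω} → PreLive j ω → ¬ Terminal j ω → Live j ω
  PreLive∧¬Terminal⇒Live zero    _    ¬t (zero , _ , t) = ¬t t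
  PreLive∧¬Terminal⇒Live zero    _    ¬t (suc _ , s≤s () , t)
  PreLive∧¬Terminal⇒Live (suc j) live ¬t (i , s≤s i≤1+j , t) with ℕ.m≤n⇒m<n∨m≡n i≤1+j
  ... | inj₁ i<1+j  = live (i , i<1+j , t)
  ... | inj₂ ≡.refl = ¬t t

  S-decreasing : ∀ {j ω} → Live j ω → S (suc j) ω Subset.⊆ S j ω
  S-decreasing {j} {ω} live {A} A∈S′ with D j ω in eq
  ... | false = ≡.subst (A Subset.∈_) (proj₂ (S-keep j live eq)) A∈S′
  ... | true with S-delete j live eq
  ...   | B , _ , _ , S′≡S-B = p─q⊆p _ _ (≡.subst (A Subset.∈_) S′≡S-B A∈S′)

  w-nonneg : ∀ j {ω A} → PreLive j ω → A Subset.∈ S j ω → 0# ≤ w j ω A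
  w-nonneg zero    _    _   = ≤-trans (0≤w₀ _) (≤-reflexive (sym (w-init _ _)))
  w-nonneg (suc j) live A∈S = proj₁ (w-step j live A∈S)

  -- A bound uniform in rounds and outcomes, so that one finite grid of thresholds serves all
  -- states.
  w≤sum-w₀ : ∀ j {ω A} → PreLive j ω → A Subset.∈ S j ω → w j ω A ≤ sum w₀
  w≤sum-w₀ zero    _    _   = ≤-trans (≤-reflexive (w-init _ _)) (term≤sum 0≤w₀ _)
  w≤sum-w₀ (suc j) live A∈S = ≤-trans (proj₂ (w-step j live A∈S)) (w≤sum-w₀ j (Live⇒PreLive j live) (S-decreasing live A∈S))

  summand-nonneg : ∀ j {ω} → PreLive j ω → ∀ A → 0# ≤ (if does (A ∈? S j ω) then w j ω A else 0#)
  summand-nonneg j {ω} pre A with A ∈? S j ω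
  ... | yes A∈S = w-nonneg j pre A∈S
  ... | no _    = ≤-refl

  w≤W : ∀ j {ω A} → PreLive j ω → A Subset.∈ S j ω → w j ω A ≤ W j ω
  w≤W j {ω} {A} pre A∈S = ≤-trans summand (term≤sum (summand-nonneg j pre) A)
    where
    summand : w j ω A ≤ (if does (A ∈? S j ω) then w j ω A else 0#)
    summand with A ∈? S j ω
    ... | yes _  = ≤-refl
    ... | no A∉S = contradiction A∈S A∉S

  W-pos : ∀ {j ω} → Live j ω → 0# < W j ω
  W-pos {j} live = ≤∧≉⇒< (sum-nonneg (summand-nonneg j (Live⇒PreLive j live))) λ W≈0 → Live⇒¬Terminal live (inj₂ W≈0)

  Positive : ℕ → Fin m → Event Ω
  Positive j A ω = PreLive j ω × A Subset.∈ S j ω × 0# < w j ω A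

  -- `Live j` is no generator of the history, whereas survival and weight events are. Weights being
  -- nonnegative, a total different from 0 means that some survivor has positive weight.
  Live≐somePositive : ∀ j → ⋃ (Fin m) (Positive j) ≐ Live j
  Live≐somePositive j = from , λ {ω} → to {ω}
    where
    from : ⋃ (Fin m) (Positive j) ⊆ Live j
    from (A , pre , A∈S , 0<w) = PreLive∧¬Terminal⇒Live j pre λ
      { (inj₁ empty) → empty (A , A∈S)
      ; (inj₂ W≈0)   → 0<w (≤-trans (w≤W j pre A∈S) (≤-reflexive W≈0)) }

    to : Live j ⊆ ⋃ (Fin m) (Positive j)
    to {ω} live with em {P = ∃ λ A → Positive j A ω}
    ... | yes positive = positive
    ... | no ¬positive = contradiction (inj₂ (sum-zero zero-summand)) (Live⇒¬Terminal live)
      where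
      pre = Live⇒PreLive j live

      zero-summand : ∀ A → (if does (A ∈? S j ω) then w j ω A else 0#) ≈ 0#
      zero-summand A with A ∈? S j ω
      ... | no _    = refl
      ... | yes A∈S with w j ω A ≤? 0#
      ...   | yes w≤0 = ≤-antisym w≤0 (w-nonneg j pre A∈S)
      ...   | no 0<w  = contradiction (A , pre , A∈S , 0<w) ¬positive

  -- Measurability with respect to the history.

  module _ (j : ℕ) where
    open SigmaAlgebraProperties em (𝓔 j) public using () renaming
      ( ∩-measurable to ∩-𝓔-measurable; const-measurable to const-𝓔-measurable; ⋃-Fin-measurable to ⋃-Fin-𝓔-measurable
      ; Attainable to Attainable-𝓔; attain-× to attain-𝓔-×; attain-∀ to attain-𝓔-∀; attain-event to attain-𝓔-event)

  open SigmaAlgebraProperties em 𝓕 using (∩-measurable; ∪-measurable; const-measurable; Decides; Decides-hereditary; Decides-constant)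
  open SigmaAlgebra 𝓕 using (≐-closed; U-measurable; ∁-measurable; ⋃-measurable)

  𝓔⊆𝓕 : ∀ {j} → Measurable (𝓔 j) ⊆ Measurable 𝓕
  𝓔⊆𝓕 (generator h)    = measurable h
  𝓔⊆𝓕 (≐-closure e mB) = ≐-closed e (𝓔⊆𝓕 mB)
  𝓔⊆𝓕 universe         = U-measurable
  𝓔⊆𝓕 (complement mB)  = ∁-measurable (𝓔⊆𝓕 mB)
  𝓔⊆𝓕 (union mB)       = ⋃-measurable λ n → 𝓔⊆𝓕 (mB n)

  History-suc : ∀ {j} → History j ⊆ History (suc j)
  History-suc (internal i≤j r)   = internal (ℕ.m≤n⇒m≤1+n i≤j) r
  History-suc (chance i<j r)     = chance (ℕ.m<n⇒m<1+n i<j) r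
  History-suc (coin i<j)         = coin (ℕ.m<n⇒m<1+n i<j)
  History-suc (law i<j A r)      = law (ℕ.m<n⇒m<1+n i<j) A r
  History-suc (sample i<j A)     = sample (ℕ.m<n⇒m<1+n i<j) A
  History-suc (survival i<j A)   = survival (ℕ.m<n⇒m<1+n i<j) A
  History-suc (weight i<j A r)   = weight (ℕ.m<n⇒m<1+n i<j) A r

  𝓔-suc : ∀ {j} → Measurable (𝓔 j) ⊆ Measurable (𝓔 (suc j))
  𝓔-suc (generator h)    = generator (History-suc h)
  𝓔-suc (≐-closure e mB) = ≐-closure e (𝓔-suc mB)
  𝓔-suc universe         = universe
  𝓔-suc (complement mB)  = complement (𝓔-suc mB)
  𝓔-suc (union mB)       = union λ n → 𝓔-suc (mB n)

  surviving-measurable : ∀ j A → Measurable (𝓔 j) (PreLive j ∩ Surviving j A)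
  surviving-measurable zero A = ≐-closure
    ((λ { {ω} _ → tt , ≡.subst (A Subset.∈_) (≡.sym (S-init ω)) ∈⊤ }) , λ _ → tt) universe
  surviving-measurable (suc j) A = generator (survival ℕ.≤-refl A)

  weight-measurable : ∀ j A r → Measurable (𝓔 j) (PreLive j ∩ Surviving j A ∩ λ ω → w j ω A ≤ r)
  weight-measurable zero A r = ≐-closure
    ( (λ { {ω} w₀≤r → tt , ≡.subst (A Subset.∈_) (≡.sym (S-init ω)) ∈⊤ , ≤-trans (≤-reflexive (w-init ω A)) w₀≤r })
    , λ { {ω} (_ , _ , w≤r) → ≤-trans (≤-reflexive (sym (w-init ω A))) w≤r })
    (const-𝓔-measurable zero (w₀ A ≤ r))
  weight-measurable (suc j) A r = generator (weight ℕ.≤-refl A r)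

  weight>-measurable : ∀ j A r → Measurable (𝓔 j) (PreLive j ∩ Surviving j A ∩ λ ω → r < w j ω A)
  weight>-measurable j A r = ≐-closure
    ( (λ { ((pre , A∈S) , ¬w≤r) → pre , A∈S , λ w≤r → ¬w≤r (pre , A∈S , w≤r) })
    , λ { (pre , A∈S , r<w) → (pre , A∈S) , λ { (_ , _ , w≤r) → r<w w≤r } })
    (∩-𝓔-measurable j (surviving-measurable j A) (complement (weight-measurable j A r)))

  Live-measurable : ∀ j → Measurable (𝓔 j) (Live j)
  Live-measurable j = ≐-closure (Live≐somePositive j) (⋃-Fin-𝓔-measurable j λ A → weight>-measurable j A 0#)

  -- Heavy and light elements.

  -- Survivors with weight in (τ, β²τ] belong to neither class. `Live j` is part of both events, so
  -- both counts vanish once the game has stopped.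
  hi lo : ℝ → ℕ → Fin m → Event Ω
  hi τ j A = Live j ∩ Surviving j A ∩ λ ω → β * β * τ < w j ω A
  lo τ j A = Live j ∩ Surviving j A ∩ λ ω → w j ω A ≤ τ

  hi-measurable : ∀ τ j A → Measurable (𝓔 j) (hi τ j A)
  hi-measurable τ j A = ≐-closure
    ((λ { (live , _ , h) → live , h }) , λ { (live , h) → live , Live⇒PreLive j live , h })
    (∩-𝓔-measurable j (Live-measurable j) (weight>-measurable j A (β * β * τ)))

  lo-measurable : ∀ τ j A → Measurable (𝓔 j) (lo τ j A)
  lo-measurable τ j A = ≐-closure
    ((λ { (live , _ , h) → live , h }) , λ { (live , h) → live , Live⇒PreLive j live , h })
    (∩-𝓔-measurable j (Live-measurable j) (weight-measurable j A τ))

  v u : ℝ → ℕ → Ω → ℝ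
  v τ j ω = count (λ A → hi τ j A ω)
  u τ j ω = count (λ A → lo τ j A ω)

  -- The value is 0 whenever `x` is 0, even if the denominator is 0 as well; in particular it is 0
  -- after the stop.
  X : ℝ → ℕ → Simple
  X τ j = tally (hi τ j) (λ A → 𝓔⊆𝓕 (hi-measurable τ j A)) λ x →
          tally (lo τ j) (λ A → 𝓔⊆𝓕 (lo-measurable τ j A)) λ y → const (x / (x + y))

  ⟦X⟧ : ∀ τ j ω → ⟦ X τ j ⟧ ω ≡ v τ j ω / (v τ j ω + u τ j ω)
  ⟦X⟧ τ j ω = ≡.trans (⟦tally⟧ (hi τ j) _ _ ω) (⟦tally⟧ (lo τ j) _ _ ω)

  X-nonneg : ∀ τ j ω → 0# ≤ ⟦ X τ j ⟧ ω
  X-nonneg τ j ω = ≤-trans (fraction-nonneg (count-nonneg _) (count-nonneg _)) (≤-reflexive (sym (reflexive (⟦X⟧ τ j ω))))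

  -- Both sides are double sums over pairs `(A , B)`, compared term by term. With `h` and `l` the
  -- indicators of heavy and light and `p` the deletion probabilities, the number of heavy elements
  -- times the chance to delete a light one is at most the number of light elements times the chance
  -- to delete a heavy one.
  weighted-sums-≤ : ∀ {n} (h l p : Fin n → ℝ) → (∀ A B → h A * (l B * p B) ≤ h A * (l B * p A)) →
                    sum h * sum (λ B → l B * p B) ≤ sum l * sum (λ A → h A * p A)
  weighted-sums-≤ h l p swap = begin
    sum h * sum (λ B → l B * p B)                ≈⟨ *-distribʳ-sum _ h ⟩
    sum (λ A → h A * sum (λ B → l B * p B))      ≤⟨ sum-mono inner ⟩
    sum (λ A → sum l * (h A * p A))              ≈⟨ *-distribˡ-sum (sum l) (λ A → h A * p A) ⟨
    sum l * sum (λ A → h A * p A)                ∎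
    where
    inner : ∀ A → h A * sum (λ B → l B * p B) ≤ sum l * (h A * p A)
    inner A = begin
      h A * sum (λ B → l B * p B)        ≈⟨ *-distribˡ-sum (h A) (λ B → l B * p B) ⟩
      sum (λ B → h A * (l B * p B))      ≤⟨ sum-mono (swap A) ⟩
      sum (λ B → h A * (l B * p A))      ≈⟨ sum-cong (λ B → solve 3 (λ h l p → h :* (l :* p) := l :* (h :* p)) refl (h A) (l B) (p A)) ⟩
      sum (λ B → l B * (h A * p A))      ≈⟨ *-distribʳ-sum (h A * p A) l ⟨
      sum l * (h A * p A)                ∎

  Deleted : ℕ → Fin m → Event Ω
  Deleted j A = Live j ∩ Coin j ∩ Sampled j A

  Deleted-measurable : ∀ j A → Measurable 𝓕 (Deleted j A)
  Deleted-measurable j A = measurable (sample {suc j} ℕ.≤-refl A)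

  τ≤ββτ : ∀ {τ} → 0# ≤ τ → τ ≤ β * β * τ
  τ≤ββτ {τ} 0≤τ = begin
    τ                   ≈⟨ trans (*-congʳ (*-identityˡ 1#)) (*-identityˡ τ) ⟨
    1# * 1# * τ         ≤⟨ *-monoˡ-≤ 0≤τ (≤-trans (*-monoʳ-≤ 0≤1 1≤β) (*-monoˡ-≤ 0≤β 1≤β)) ⟩
    β * β * τ           ∎

  -- The supermartingale at a fixed threshold.

  module _ {τ : ℝ} (0≤τ : 0# ≤ τ) where

    hi⇒¬lo : ∀ {j A ω} → hi τ j A ω → ¬ lo τ j A ω
    hi⇒¬lo (_ , _ , t<w) (_ , _ , w≤τ) = t<w (≤-trans w≤τ (τ≤ββτ 0≤τ))

    -- The bound on `u` is asked for on `Live j` only: stopping makes `u` drop to 0, but then `v`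
    -- and the fraction are 0 too.
    X≤fraction : ∀ j {ω p q} → 0# ≤ q → v τ j ω ≤ p → (Live j ω → q ≤ u τ j ω) → ⟦ X τ j ⟧ ω ≤ p / (p + q)
    X≤fraction j {ω} {p} {q} 0≤q v≤p q≤u with em {P = Live j ω}
    ... | yes live = ≤-trans (≤-reflexive (reflexive (⟦X⟧ τ j ω))) (fraction-mono (count-nonneg _) v≤p 0≤q (q≤u live))
    ... | no ¬live = ≤-trans (≤-reflexive (trans (reflexive (⟦X⟧ τ j ω)) (0/x≈0 (count-empty λ A h → ¬live (proj₁ h)))))
                             (fraction-nonneg (≤-trans (count-nonneg _) v≤p) 0≤q)

    module _ {j ω} (live : Live j ω) where

      hi-shrinks : ∀ A → hi τ (suc j) A ω → hi τ j A ω
      hi-shrinks A (_ , A∈S′ , t<w′) = live , S-decreasing live A∈S′ , <-≤-trans t<w′ (proj₂ (w-step j live A∈S′))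

      lo-persists : ∀ A → Live (suc j) ω → A Subset.∈ S (suc j) ω → lo τ j A ω → lo τ (suc j) A ω
      lo-persists A live′ A∈S′ (_ , _ , w≤τ) = live′ , A∈S′ , ≤-trans (proj₂ (w-step j live A∈S′)) w≤τ

      X-mono-keep : D j ω ≡ false → ⟦ X τ (suc j) ⟧ ω ≤ ⟦ X τ j ⟧ ω
      X-mono-keep D≡false = ≤-trans
        (X≤fraction (suc j) (count-nonneg _) (count-mono hi-shrinks) λ live′ → count-mono λ A l →
          lo-persists A live′ (≡.subst (A Subset.∈_) (≡.sym (proj₂ (S-keep j live D≡false))) (proj₁ (proj₂ l))) l)
        (≤-reflexive (reflexive (≡.sym (⟦X⟧ τ j ω))))

      module _ {A} (S′≡S-A : S (suc j) ω ≡ S j ω Subset.- A) where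

        private
          hi-remove : ∀ B → hi τ (suc j) B ω → hi τ j B ω × B ≢ A
          hi-remove B h = hi-shrinks B h , λ { ≡.refl →
            x∈p─q⇒x∉q (S j ω) Subset.⁅ A ⁆ (≡.subst (B Subset.∈_) S′≡S-A (proj₁ (proj₂ h))) (x∈⁅x⁆ A) }

          lo-remove : Live (suc j) ω → ∀ B → lo τ j B ω → B ≢ A → lo τ (suc j) B ω
          lo-remove live′ B l B≢A = lo-persists B live′
            (≡.subst (B Subset.∈_) (≡.sym S′≡S-A) (x∈p∧x≢y⇒x∈p-y (proj₁ (proj₂ l)) B≢A)) l

        X-delete-hi : hi τ j A ω → ⟦ X τ (suc j) ⟧ ω ≤ (v τ j ω - 1#) / ((v τ j ω - 1#) + u τ j ω)
        X-delete-hi hA = X≤fraction (suc j) (count-nonneg _) (count-remove-≤ A hA hi-remove)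
          λ live′ → count-mono λ B l → lo-remove live′ B l λ { ≡.refl → hi⇒¬lo hA l }

        X-delete-lo : lo τ j A ω → ⟦ X τ (suc j) ⟧ ω ≤ v τ j ω / (v τ j ω + (u τ j ω - 1#))
        X-delete-lo lA = X≤fraction (suc j) (x+z≤y⇒x≤y-z (≤-trans (≤-reflexive (+-identityˡ 1#)) (count-inhabited A lA)))
          (count-mono hi-shrinks) λ live′ → count-remove-≥ A (lo-remove live′)

        X-delete-other : ¬ lo τ j A ω → ⟦ X τ (suc j) ⟧ ω ≤ ⟦ X τ j ⟧ ω
        X-delete-other ¬lA = ≤-trans
          (X≤fraction (suc j) (count-nonneg _) (count-mono hi-shrinks)
            λ live′ → count-mono λ B l → lo-remove live′ B l λ { ≡.refl → ¬lA l })
          (≤-reflexive (reflexive (≡.sym (⟦X⟧ τ j ω))))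

    -- The origin of β²: one factor is the upper bound on the probability of the light element, the
    -- other the lower bound on that of the heavy one.
    π-hi-≥-π-lo : ∀ {j A B ω} → Coin j ω → hi τ j A ω → lo τ j B ω → π j ω B ≤ π j ω A
    π-hi-≥-π-lo {j} {A} {B} {ω} c (live , A∈S , t<w) (_ , B∈S , w≤τ) = begin
      π j ω B                          ≤⟨ proj₂ (π-bounds j live c B∈S) ⟩
      β * (w j ω B / W j ω)            ≤⟨ *-monoʳ-≤ 0≤β (*-monoˡ-≤ 0≤W⁻¹ w≤τ) ⟩
      β * (τ / W j ω)                  ≈⟨ *-identityˡ _ ⟨
      1# * (β * (τ / W j ω))           ≈⟨ *-congʳ (⁻¹-inverseʳ (<⇒≉ 0<β)) ⟨
      β * β ⁻¹ * (β * (τ / W j ω))     ≈⟨ solve 4 (λ b c t d → b :* c :* (b :* (t :* d)) := c :* (b :* b :* t :* d)) refl β (β ⁻¹) τ (W j ω ⁻¹) ⟩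
      β ⁻¹ * (β * β * τ / W j ω)       ≤⟨ *-monoʳ-≤ (⁻¹-nonneg 0<β) (*-monoˡ-≤ 0≤W⁻¹ (<⇒≤ t<w)) ⟩
      β ⁻¹ * (w j ω A / W j ω)         ≤⟨ proj₁ (π-bounds j live c A∈S) ⟩
      π j ω A                          ∎
      where
      0≤W⁻¹ = ⁻¹-nonneg (W-pos live)

    -- `G ∩ Coin j` belongs to `𝓔⁺ j`, where the law of `A*` is known, and on it both `A` and `B`
    -- survive. The two probabilities are thus integrals over the same event, and the pointwise
    -- inequality of the integrands suffices.
    P-lo-≤-P-hi : ∀ {j G A B} → Measurable (𝓔 j) G → G ⊆ hi τ j A → G ⊆ lo τ j B →
                  P (G ∩ Deleted j B) ≤ P (G ∩ Deleted j A)
    P-lo-≤-P-hi {j} {G} {A} {B} mG G⊆hi G⊆lo = begin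
      P (G ∩ Deleted j B)             ≈⟨ regroup B ⟩
      P ((G ∩ Coin j) ∩ Sampled j B)  ≤⟨ IsIntegral-mono (λ (g , c) → π-hi-≥-π-lo c (G⊆hi g) (G⊆lo g))
                                           (law-of B (λ g → proj₁ (proj₂ (G⊆lo g)))) (law-of A (λ g → proj₁ (proj₂ (G⊆hi g)))) ⟩
      P ((G ∩ Coin j) ∩ Sampled j A)  ≈⟨ regroup A ⟨
      P (G ∩ Deleted j A)             ∎
      where
      G⊆Live : G ⊆ Live j
      G⊆Live g = proj₁ (G⊆hi g)

      regroup : ∀ C → P (G ∩ Deleted j C) ≈ P ((G ∩ Coin j) ∩ Sampled j C)
      regroup C = P-cong (∩-measurable (𝓔⊆𝓕 mG) (Deleted-measurable j C))
        ((λ (g , _ , c , s) → (g , c) , s) , λ ((g , c) , s) → g , G⊆Live g , c , s)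

      law-of : ∀ C → G ⊆ Surviving j C → IsIntegral prob (λ ω → π j ω C) (G ∩ Coin j) (P ((G ∩ Coin j) ∩ Sampled j C))
      law-of C G⊆S = proj₂ (A*-law j C)
        -- The extra generator of `𝓔⁺ j` is `Live j ∩ Coin j`, not the bare coin event; liveness is
        -- automatic on `G`.
        (≐-closure ((λ (g , _ , c) → g , c) , λ (g , c) → g , G⊆Live g , c)
          (∩-𝓔⁺-measurable (generator (inj₁ mG)) (generator (inj₂ ≡.refl))))
        (λ (g , c) → G⊆Live g , c , G⊆S g)
        where
        open SigmaAlgebraProperties em (𝓔⁺ j) using () renaming (∩-measurable to ∩-𝓔⁺-measurable)

    -- On G the sets of heavy and of light elements are constant; ω₀ supplies their values.
    module Atom {j G} (mG : Measurable (𝓔 j) G) (G⊆Live : G ⊆ Live j)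
                (hi-decided : ∀ A → Decides (hi τ j A) G) (lo-decided : ∀ A → Decides (lo τ j A) G)
                {ω₀} (ω₀∈G : ω₀ ∈ G) where
      private
        mG′ = 𝓔⊆𝓕 mG
        v₀  = v τ j ω₀
        u₀  = u τ j ω₀

        h l : Fin m → ℝ
        h A = ind (hi τ j A ω₀)
        l A = ind (lo τ j A ω₀)

        to-hi : ∀ {ω A} → ω ∈ G → hi τ j A ω₀ → hi τ j A ω
        to-hi {A = A} = Decides-constant (hi-decided A) ω₀∈G

        to-lo : ∀ {ω A} → ω ∈ G → lo τ j A ω₀ → lo τ j A ω
        to-lo {A = A} = Decides-constant (lo-decided A) ω₀∈G

        from-hi : ∀ {ω A} → ω ∈ G → hi τ j A ω → hi τ j A ω₀
        from-hi {A = A} g = Decides-constant (hi-decided A) g ω₀∈G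

        from-lo : ∀ {ω A} → ω ∈ G → lo τ j A ω → lo τ j A ω₀
        from-lo {A = A} g = Decides-constant (lo-decided A) g ω₀∈G

        v-constant : ∀ {ω} → ω ∈ G → v τ j ω ≈ v₀
        v-constant g = ≤-antisym (count-mono λ A → from-hi g) (count-mono λ A → to-hi g)

        u-constant : ∀ {ω} → ω ∈ G → u τ j ω ≈ u₀
        u-constant g = ≤-antisym (count-mono λ A → from-lo g) (count-mono λ A → to-lo g)

        X-constant : ∀ {ω} → ω ∈ G → ⟦ X τ j ⟧ ω ≈ v₀ / (v₀ + u₀)
        X-constant {ω} g = trans (reflexive (⟦X⟧ τ j ω)) (/-cong (v-constant g) (+-cong (v-constant g) (u-constant g)))

        deleted : Fin m → Simple
        deleted A = indicator (Deleted j A) (Deleted-measurable j A)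

        -- On `G` this is `f` at the deleted element, and 0 in a round without deletion.
        weighted : (Fin m → ℝ) → Simple
        weighted f = ∑ λ A → f A ⊛ deleted A

        𝔼-weighted : ∀ f → 𝔼 (weighted f) G ≈ sum (λ A → f A * P (G ∩ Deleted j A))
        𝔼-weighted f = trans (𝔼-∑ (λ A → f A ⊛ deleted A) G) (sum-cong λ A → *-congˡ (𝔼-indicator (Deleted-measurable j A)))

        weighted-keep : ∀ f {ω} → D j ω ≡ false → ⟦ weighted f ⟧ ω ≈ 0#
        weighted-keep f {ω} D≡false = trans (reflexive (⟦∑⟧ (λ A → f A ⊛ deleted A) ω)) (sum-zero λ A →
          trans (*-congˡ (reflexive (ind-no λ (_ , c , _) → contradiction (≡.trans (≡.sym D≡false) c) λ ()))) (zeroʳ (f A)))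

        weighted-delete : ∀ f {ω A} → ω ∈ G → D j ω ≡ true → A* j ω ≡ just A → ⟦ weighted f ⟧ ω ≈ f A
        weighted-delete f {ω} {A} g D≡true A*≡A = trans (reflexive (⟦∑⟧ (λ A → f A ⊛ deleted A) ω)) (trans
          (sum-single A λ B B≢A → trans
            (*-congˡ (reflexive (ind-no λ (_ , _ , A*≡B) → B≢A (just-injective (≡.trans (≡.sym A*≡B) A*≡A))))) (zeroʳ (f B)))
          (trans (*-congˡ (reflexive (ind-yes (G⊆Live g , D≡true , A*≡A)))) (*-identityʳ (f A))))

        module Balanced (1≤v₀ : 1# ≤ v₀) (1≤u₀ : 1# ≤ u₀) where
          private
            k = κ v₀ u₀

          -- Deleting a heavy element lowers the fraction by at least `k * u₀`, deleting a light one
          -- raises it by at most `k * v₀`. Each change is added on the side where it is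
          -- nonnegative; the inequality between the two sides is pointwise, and only `corrections`
          -- uses probabilities.
          Lhs Rhs : Simple
          Lhs = X τ (suc j) ⊕ (k * u₀) ⊛ weighted h
          Rhs = X τ j       ⊕ (k * v₀) ⊛ weighted l

          ⟦Lhs⟧≤⟦Rhs⟧ : ∀ {ω} → ω ∈ G → ⟦ Lhs ⟧ ω ≤ ⟦ Rhs ⟧ ω
          ⟦Lhs⟧≤⟦Rhs⟧ {ω} g with D j ω in eq
          ... | false = +-mono-≤ (X-mono-keep (G⊆Live g) eq) (≤-reflexive (*-scale (weighted-keep h eq) (weighted-keep l eq)))
            where
            *-scale : ∀ {a b x y} → x ≈ 0# → y ≈ 0# → a * x ≈ b * y
            *-scale x≈0 y≈0 = trans (trans (*-congˡ x≈0) (zeroʳ _)) (sym (trans (*-congˡ y≈0) (zeroʳ _)))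
          ... | true with S-delete j (G⊆Live g) eq
          ...   | A , A*≡A , _ , S′≡S-A = delete em em
            where
            live = G⊆Live g

            value : ∀ {x a} f s → f A ≡ x → ⟦ s ⟧ ω + a * ⟦ weighted f ⟧ ω ≈ ⟦ s ⟧ ω + a * x
            value f s fA≡x = +-congˡ (*-congˡ (trans (weighted-delete f g eq A*≡A) (reflexive fA≡x)))

            drop : ∀ {x a} → x + a * 0# ≈ x
            drop = trans (+-congˡ (zeroʳ _)) (+-identityʳ _)

            delete : Dec (hi τ j A ω₀) → Dec (lo τ j A ω₀) → ⟦ Lhs ⟧ ω ≤ ⟦ Rhs ⟧ ω
            delete (yes hA) _ = begin
              ⟦ Lhs ⟧ ω                                    ≈⟨ trans (value h (X τ (suc j)) (ind-yes hA)) (+-congˡ (*-identityʳ _)) ⟩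
              ⟦ X τ (suc j) ⟧ ω + k * u₀                   ≤⟨ +-monoˡ-≤ _ (X-delete-hi live S′≡S-A (to-hi g hA)) ⟩
              (v τ j ω - 1#) / ((v τ j ω - 1#) + u τ j ω) + k * u₀
                ≈⟨ +-congʳ (/-cong (+-congʳ (v-constant g)) (+-cong (+-congʳ (v-constant g)) (u-constant g))) ⟩
              (v₀ - 1#) / ((v₀ - 1#) + u₀) + k * u₀        ≈⟨ fraction-remove-v 1≤v₀ 1≤u₀ ⟩
              v₀ / (v₀ + u₀)                               ≈⟨ X-constant g ⟨
              ⟦ X τ j ⟧ ω                                  ≈⟨ drop ⟨
              ⟦ X τ j ⟧ ω + k * v₀ * 0#                    ≈⟨ value l (X τ j) (ind-no (hi⇒¬lo hA)) ⟨
              ⟦ Rhs ⟧ ω                                    ∎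
            delete (no ¬hA) (yes lA) = begin
              ⟦ Lhs ⟧ ω                                    ≈⟨ trans (value h (X τ (suc j)) (ind-no ¬hA)) drop ⟩
              ⟦ X τ (suc j) ⟧ ω                            ≤⟨ X-delete-lo live S′≡S-A (to-lo g lA) ⟩
              v τ j ω / (v τ j ω + (u τ j ω - 1#))         ≈⟨ /-cong (v-constant g) (+-cong (v-constant g) (+-congʳ (u-constant g))) ⟩
              v₀ / (v₀ + (u₀ - 1#))                        ≈⟨ fraction-remove-u 1≤v₀ 1≤u₀ ⟩
              v₀ / (v₀ + u₀) + k * v₀                      ≈⟨ +-cong (X-constant g) (*-identityʳ _) ⟨
              ⟦ X τ j ⟧ ω + k * v₀ * 1#                    ≈⟨ value l (X τ j) (ind-yes lA) ⟨
              ⟦ Rhs ⟧ ω                                    ∎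
            delete (no ¬hA) (no ¬lA) = begin
              ⟦ Lhs ⟧ ω                                    ≈⟨ trans (value h (X τ (suc j)) (ind-no ¬hA)) drop ⟩
              ⟦ X τ (suc j) ⟧ ω                            ≤⟨ X-delete-other live S′≡S-A (¬lA ∘ from-lo g) ⟩
              ⟦ X τ j ⟧ ω                                  ≈⟨ drop ⟨
              ⟦ X τ j ⟧ ω + k * v₀ * 0#                    ≈⟨ value l (X τ j) (ind-no ¬lA) ⟨
              ⟦ Rhs ⟧ ω                                    ∎

          swap : ∀ A B → h A * (l B * P (G ∩ Deleted j B)) ≤ h A * (l B * P (G ∩ Deleted j A))
          swap A B with em {P = hi τ j A ω₀}
          ... | no _ = ≤-reflexive (trans (zeroˡ _) (sym (zeroˡ _)))
          ... | yes hA with em {P = lo τ j B ω₀}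
          ...   | no _ = *-monoʳ-≤ 0≤1 (≤-reflexive (trans (zeroˡ _) (sym (zeroˡ _))))
          ...   | yes lB = *-monoʳ-≤ 0≤1 (*-monoʳ-≤ 0≤1 (P-lo-≤-P-hi mG (λ g → to-hi g hA) (λ g → to-lo g lB)))

          corrections : (k * v₀) * 𝔼 (weighted l) G ≤ (k * u₀) * 𝔼 (weighted h) G
          corrections = begin
            (k * v₀) * 𝔼 (weighted l) G                        ≈⟨ trans (*-assoc k v₀ _) (*-congˡ (*-congˡ (𝔼-weighted l))) ⟩
            k * (v₀ * sum (λ A → l A * P (G ∩ Deleted j A)))   ≤⟨ *-monoʳ-≤ (κ-nonneg 1≤v₀ 1≤u₀) (weighted-sums-≤ h l _ swap) ⟩
            k * (u₀ * sum (λ A → h A * P (G ∩ Deleted j A)))   ≈⟨ trans (*-assoc k u₀ _) (*-congˡ (*-congˡ (𝔼-weighted h))) ⟨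
            (k * u₀) * 𝔼 (weighted h) G                        ∎

          conclusion : 𝔼 (X τ (suc j)) G ≤ 𝔼 (X τ j) G
          conclusion = +-cancelʳ-≤ _ (≤-trans (𝔼-mono Lhs Rhs mG′ ⟦Lhs⟧≤⟦Rhs⟧) (+-monoʳ-≤ _ corrections))

        -- Without heavy elements X stays 0; without light ones it cannot increase.
        unbalanced : ¬ ((∃ λ A → hi τ j A ω₀) × (∃ λ A → lo τ j A ω₀)) → 𝔼 (X τ (suc j)) G ≤ 𝔼 (X τ j) G
        unbalanced ¬both = 𝔼-mono (X τ (suc j)) (X τ j) mG′ λ g → pointwise g em
          where
          pointwise : ∀ {ω} → ω ∈ G → Dec (∃ λ A → lo τ j A ω₀) → ⟦ X τ (suc j) ⟧ ω ≤ ⟦ X τ j ⟧ ω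
          pointwise {ω} g (yes some-lo) = ≤-trans (≤-reflexive (trans (reflexive (⟦X⟧ τ (suc j) ω))
            (0/x≈0 (count-empty λ A hA → ¬both ((A , from-hi g (hi-shrinks (G⊆Live g) A hA)) , some-lo)))))
            (X-nonneg τ j ω)
          pointwise {ω} g (no no-lo) = ≤-trans
            (X≤fraction (suc j) (count-nonneg _) (count-mono (hi-shrinks (G⊆Live g)))
              λ _ → ≤-trans (≤-reflexive (count-empty λ A lA → no-lo (A , from-lo g lA))) (count-nonneg _))
            (≤-reflexive (reflexive (≡.sym (⟦X⟧ τ j ω))))

      step : 𝔼 (X τ (suc j)) G ≤ 𝔼 (X τ j) G
      step with em {P = (∃ λ A → hi τ j A ω₀) × (∃ λ A → lo τ j A ω₀)}
      ... | yes ((A , hA) , (B , lB)) = Balanced.conclusion (count-inhabited A hA) (count-inhabited B lB)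
      ... | no ¬both                  = unbalanced ¬both

    -- The splitting takes place in `𝓔 j` and not merely in `𝓕`, because the conditional law behind
    -- `Atom` is available on history events only. On the stopped pieces `X τ (suc j)` is 0.
    supermartingale-step : ∀ j {G} → Measurable (𝓔 j) G → 𝔼 (X τ (suc j)) G ≤ 𝔼 (X τ j) G
    supermartingale-step j = attain-𝓔-× j Decides-hereditary (attain-𝓔-event j (Live-measurable j))
      (attain-𝓔-× j (λ H⊆G d A → Decides-hereditary H⊆G (d A))
        (attain-𝓔-∀ j (λ _ → Decides-hereditary) (λ A → attain-𝓔-event j (hi-measurable τ j A)))
        (attain-𝓔-∀ j (λ _ → Decides-hereditary) (λ A → attain-𝓔-event j (lo-measurable τ j A))))
      (λ G → 𝔼 (X τ (suc j)) G ≤ 𝔼 (X τ j) G)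
      (λ mE mG p q → ≤-trans (≤-reflexive (𝔼-split (X τ (suc j)) (𝓔⊆𝓕 mG) (𝓔⊆𝓕 mE)))
        (≤-trans (+-mono-≤ p q) (≤-reflexive (sym (𝔼-split (X τ j) (𝓔⊆𝓕 mG) (𝓔⊆𝓕 mE))))))
      atom
      where
      atom : ∀ {G} → Measurable (𝓔 j) G →
             Decides (Live j) G × (∀ A → Decides (hi τ j A) G) × (∀ A → Decides (lo τ j A) G) →
             𝔼 (X τ (suc j)) G ≤ 𝔼 (X τ j) G
      atom {G} mG (inj₂ G⊆∁Live , _) = 𝔼-mono (X τ (suc j)) (X τ j) (𝓔⊆𝓕 mG) λ {ω} g → ≤-trans
        (≤-reflexive (trans (reflexive (⟦X⟧ τ (suc j) ω)) (0/x≈0 (count-empty λ A hA → G⊆∁Live g (Live-pred (proj₁ hA))))))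
        (X-nonneg τ j ω)
      atom {G} mG (inj₁ G⊆Live , hd , ld) with em {P = Satisfiable G}
      ... | yes (ω₀ , g) = Atom.step mG G⊆Live hd ld g
      ... | no empty     = 𝔼-mono (X τ (suc j)) (X τ j) (𝓔⊆𝓕 mG) λ g → contradiction (_ , g) empty

    𝓔-mono : ∀ {s} d → Measurable (𝓔 s) ⊆ Measurable (𝓔 (d ℕ.+ s))
    𝓔-mono zero    mG = mG
    𝓔-mono (suc d) mG = 𝓔-suc (𝓔-mono d mG)

    supermartingale : ∀ {s} d {G} → Measurable (𝓔 s) G → 𝔼 (X τ (d ℕ.+ s)) G ≤ 𝔼 (X τ s) G
    supermartingale zero    mG = ≤-refl
    supermartingale {s} (suc d) mG = ≤-trans (supermartingale-step (d ℕ.+ s) (𝓔-mono d mG)) (supermartingale d mG)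

  -- Rounding to a grid, and the average weight.

  module _ {γ : ℝ} (0≤γ : 0# ≤ γ) where

    -- The right side rounds `y` up to the grid `θ`; `y ≤ θ N` ensures that the grid reaches far
    -- enough.
    layers-≥ : ∀ N (θ : ℕ → ℝ) {y} → (∀ i → θ (suc i) ≈ θ i + γ) → y ≤ θ N →
               y ≤ θ 0 + γ * sum {N} (λ i → ind (θ (toℕ i) < y))
    layers-≥ zero    θ     θ-suc y≤θ = ≤-trans y≤θ (≤-reflexive (sym (trans (+-congˡ (zeroʳ γ)) (+-identityʳ (θ 0)))))
    layers-≥ (suc N) θ {y} θ-suc y≤θ with y ≤? θ 0
    ... | yes y≤θ₀ = ≤-trans y≤θ₀ (x≤x+nonneg (*-nonNegative 0≤γ (sum-nonneg {suc N} λ i → ind-nonneg (θ (toℕ i) < y))))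
    ... | no  θ₀<y = begin
      y                                 ≤⟨ layers-≥ N (θ ∘ suc) (θ-suc ∘ suc) y≤θ ⟩
      θ 1 + γ * rest                    ≈⟨ +-congʳ (θ-suc 0) ⟩
      (θ 0 + γ) + γ * rest              ≈⟨ trans (+-assoc (θ 0) γ _) (+-congˡ (+-congʳ (sym (*-identityʳ γ)))) ⟩
      θ 0 + (γ * 1# + γ * rest)         ≈⟨ +-congˡ (distribˡ γ 1# rest) ⟨
      θ 0 + γ * (1# + rest)             ≈⟨ +-congˡ (*-congˡ (+-congʳ (reflexive (ind-yes θ₀<y)))) ⟨
      θ 0 + γ * (ind (θ 0 < y) + rest)  ∎
      where rest = sum {N} (λ i → ind (θ (suc (toℕ i)) < y))

    -- Rounding up overshoots by at most one step `γ`; a `y` beyond the grid is rounded down to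
    -- `θ N`.
    layers-≤ : ∀ N (θ : ℕ → ℝ) {y} → (∀ i → θ (suc i) ≈ θ i + γ) → θ 0 ≤ y →
               θ 0 + γ * sum {N} (λ i → ind (θ (toℕ i) < y)) ≤ y + γ
    layers-≤ zero    θ     θ-suc θ₀≤y = +-mono-≤ θ₀≤y (≤-trans (≤-reflexive (zeroʳ γ)) 0≤γ)
    layers-≤ (suc N) θ {y} θ-suc θ₀≤y with θ 1 ≤? y
    ... | yes θ₁≤y = begin
      θ 0 + γ * (ind (θ 0 < y) + rest)  ≤⟨ +-monoʳ-≤ (θ 0) (*-monoʳ-≤ 0≤γ (+-monoˡ-≤ rest (ind≤1 _))) ⟩
      θ 0 + γ * (1# + rest)             ≈⟨ +-congˡ (trans (distribˡ γ 1# rest) (+-congʳ (*-identityʳ γ))) ⟩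
      θ 0 + (γ + γ * rest)              ≈⟨ trans (+-congʳ (θ-suc 0)) (+-assoc (θ 0) γ _) ⟨
      θ 1 + γ * rest                    ≤⟨ layers-≤ N (θ ∘ suc) (θ-suc ∘ suc) θ₁≤y ⟩
      y + γ                             ∎
      where rest = sum {N} (λ i → ind (θ (suc (toℕ i)) < y))
    -- Since `y` lies below `θ 1` and `θ` increases, only the first threshold can count.
    ... | no y<θ₁ = +-mono-≤ θ₀≤y (≤-trans (*-monoʳ-≤ 0≤γ first≤1) (≤-reflexive (*-identityʳ γ)))
      where
      θ₁≤ : ∀ i → θ 1 ≤ θ (suc i)
      θ₁≤ zero    = ≤-refl
      θ₁≤ (suc i) = ≤-trans (θ₁≤ i) (≤-trans (x≤x+nonneg 0≤γ) (≤-reflexive (sym (θ-suc (suc i)))))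

      first≤1 : sum {suc N} (λ i → ind (θ (toℕ i) < y)) ≤ 1#
      first≤1 = ≤-trans (+-mono-≤ (ind≤1 (θ 0 < y))
                                  (≤-reflexive (sum-zero {N} λ i → reflexive (ind-no λ θ<y → <-≤-trans y<θ₁ (θ₁≤ (toℕ i)) (<⇒≤ θ<y)))))
                        (≤-reflexive (+-identityʳ 1#))

  ∣p∣≈count : ∀ {n} (p : Subset n) → fromℕ ∣ p ∣ ≈ sum (λ A → ind (A Subset.∈ p))
  ∣p∣≈count []      = refl
  ∣p∣≈count {suc n} (b ∷ p) = by-head b
    where
    tail-count : ∀ b → fromℕ ∣ p ∣ ≈ sum {n} (λ A → ind (suc A Subset.∈ b ∷ p))
    tail-count b = trans (∣p∣≈count p) (sum-cong {n} λ A → ind-cong {A Subset.∈ p} {suc A Subset.∈ b ∷ p} there drop-there)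

    by-head : ∀ b → fromℕ ∣ b ∷ p ∣ ≈ sum (λ A → ind (A Subset.∈ b ∷ p))
    by-head inside  = +-cong (reflexive (≡.sym (ind-yes here))) (tail-count inside)
    by-head outside = trans (tail-count outside) (sym (trans (+-congʳ (reflexive (ind-no λ ()))) (+-identityˡ _)))

  ρ-live : ∀ {j ω} → Live j ω → ρ j ω ≡ W j ω / fromℕ ∣ S j ω ∣
  ρ-live {j} {ω} live with stopped? j ω
  ... | yes stopped = contradiction stopped live
  ... | no _        = ≡.refl

  ρ-stopped : ∀ {j ω} → ¬ Live j ω → ρ j ω ≡ 0#
  ρ-stopped {j} {ω} ¬live with stopped? j ω
  ... | yes _ = ≡.refl
  ... | no live = contradiction live ¬live

  W≈ : ∀ j ω → W j ω ≈ sum (λ A → ind (A Subset.∈ S j ω) * w j ω A)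
  W≈ j ω = sum-cong term
    where
    term : ∀ A → (if does (A ∈? S j ω) then w j ω A else 0#) ≈ ind (A Subset.∈ S j ω) * w j ω A
    term A with A ∈? S j ω
    ... | yes A∈S = sym (trans (*-congʳ (reflexive (ind-yes A∈S))) (*-identityˡ _))
    ... | no A∉S  = sym (trans (*-congʳ (reflexive (ind-no A∉S))) (zeroˡ _))

  module _ {j ω} (live : Live j ω) where
    private
      n = fromℕ ∣ S j ω ∣

      Above : ℝ → Fin m → Set
      Above τ A = A Subset.∈ S j ω × τ < w j ω A

    n-pos : 0# < n
    n-pos with proj₂ (Live≐somePositive j) live
    ... | A , _ , A∈S , _ = <-≤-trans 0<1 (≤-trans (count-inhabited A A∈S) (≤-reflexive (sym (∣p∣≈count (S j ω)))))

    above+u≈n : ∀ τ → count (Above τ) + u τ j ω ≈ n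
    above+u≈n τ = trans (sym (∑-distrib-+ (λ A → ind (Above τ A)) (λ A → ind (lo τ j A ω))))
      (trans (sum-cong term) (sym (∣p∣≈count (S j ω))))
      where
      term : ∀ A → ind (Above τ A) + ind (lo τ j A ω) ≈ ind (A Subset.∈ S j ω)
      term A with em {P = A Subset.∈ S j ω}
      ... | no A∉S = trans (+-cong (reflexive (ind-no (A∉S ∘ proj₁))) (reflexive (ind-no (A∉S ∘ proj₁ ∘ proj₂)))) (+-identityʳ 0#)
      ... | yes A∈S with w j ω A ≤? τ
      ...   | yes w≤τ = trans (+-cong (reflexive (ind-no λ (_ , τ<w) → τ<w w≤τ)) (reflexive (ind-yes (live , A∈S , w≤τ)))) (+-identityˡ 1#)
      ...   | no τ<w  = trans (+-cong (reflexive (ind-yes (A∈S , τ<w))) (reflexive (ind-no λ (_ , _ , w≤τ) → τ<w w≤τ))) (+-identityʳ 1#)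

    v≤above : ∀ {τ} → 0# ≤ τ → v τ j ω ≤ count (Above τ)
    v≤above 0≤τ = count-mono λ A (_ , A∈S , t<w) → A∈S , ≤-<-trans (τ≤ββτ 0≤τ) t<w

    -- Counting the elements between `τ` and `β * β * τ` as heavy enlarges the fraction and turns
    -- its denominator into `n`.
    X≤above/n : ∀ {τ} → 0# ≤ τ → ⟦ X τ j ⟧ ω ≤ count (Above τ) / n
    X≤above/n {τ} 0≤τ = begin
      ⟦ X τ j ⟧ ω                                  ≈⟨ reflexive (⟦X⟧ τ j ω) ⟩
      v τ j ω / (v τ j ω + u τ j ω)                ≤⟨ fraction-mono (count-nonneg _) (v≤above 0≤τ) (count-nonneg _) ≤-refl ⟩
      count (Above τ) / (count (Above τ) + u τ j ω) ≈⟨ /-congˡ (above+u≈n τ) ⟩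
      count (Above τ) / n                          ∎

    -- Counting the same elements as light lowers the fraction, again with denominator `n`.
    v/n≤X : ∀ {τ} → 0# ≤ τ → v τ j ω / n ≤ ⟦ X τ j ⟧ ω
    v/n≤X {τ} 0≤τ = begin
      v τ j ω / n                          ≈⟨ /-congˡ (trans (+-comm _ _) (-+-cancel n (v τ j ω))) ⟨
      v τ j ω / (v τ j ω + (n - v τ j ω))  ≤⟨ fraction-mono (count-nonneg _) ≤-refl (count-nonneg _) (x+z≤y⇒x≤y-z u+v≤n) ⟩
      v τ j ω / (v τ j ω + u τ j ω)        ≈⟨ reflexive (⟦X⟧ τ j ω) ⟨
      ⟦ X τ j ⟧ ω                          ∎
      where
      u+v≤n : u τ j ω + v τ j ω ≤ n
      u+v≤n = ≤-trans (≤-reflexive (+-comm _ _)) (≤-trans (+-monoˡ-≤ _ (v≤above 0≤τ)) (≤-reflexive (above+u≈n τ)))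

  -- Summation over a grid of thresholds.

  module Grid {η : ℝ} (0<η : 0# < η) (N : ℕ) (bound : sum w₀ ≤ N · η) where

    0≤η = <⇒≤ 0<η

    τ : Fin N → ℝ
    τ i = toℕ i · η

    0≤· : ∀ i → 0# ≤ i · η
    0≤· zero    = ≤-refl
    0≤· (suc i) = +-nonneg 0≤η (0≤· i)

    0≤τ : ∀ i → 0# ≤ τ i
    0≤τ i = 0≤· (toℕ i)

    Z : ℕ → Simple
    Z j = ∑ λ i → X (τ i) j

    Z-nonneg : ∀ j ω → 0# ≤ ⟦ Z j ⟧ ω
    Z-nonneg j ω = ≤-trans (sum-nonneg λ i → X-nonneg (τ i) j ω) (≤-reflexive (sym (reflexive (⟦∑⟧ (λ i → X (τ i) j) ω))))

    -- The spacing of the heavy thresholds, against `η` for the light ones; the ratio β² is the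
    -- constant of the theorem.
    c : ℝ
    c = β * β * η

    0≤c : 0# ≤ c
    0≤c = *-nonNegative (*-nonNegative 0≤β 0≤β) 0≤η

    -- Each weight is rounded up along the heavy thresholds, which start at 0. Exchanging the two
    -- sums collects the counts `v`, and division by `n` gives fractions below `X`.
    ρ≤cZ : ∀ j ω → ρ j ω ≤ c * ⟦ Z j ⟧ ω
    ρ≤cZ j ω with em {P = Live j ω}
    ... | no ¬live = ≤-trans (≤-reflexive (reflexive (ρ-stopped ¬live))) (*-nonNegative 0≤c (Z-nonneg j ω))
    ... | yes live = begin
      ρ j ω                                    ≈⟨ reflexive (ρ-live live) ⟩
      W j ω / n                                ≤⟨ *-monoˡ-≤ (⁻¹-nonneg (n-pos live)) W≤ ⟩
      (c * sum (λ i → v (τ i) j ω)) / n        ≈⟨ trans (*-assoc c _ _) (*-congˡ (*-distribʳ-sum (n ⁻¹) (λ i → v (τ i) j ω))) ⟩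
      c * sum (λ i → v (τ i) j ω / n)          ≤⟨ *-monoʳ-≤ 0≤c (sum-mono λ i → v/n≤X live (0≤τ i)) ⟩
      c * sum (λ i → ⟦ X (τ i) j ⟧ ω)          ≈⟨ *-congˡ (reflexive (⟦∑⟧ (λ i → X (τ i) j) ω)) ⟨
      c * ⟦ Z j ⟧ ω                            ∎
      where
      n = fromℕ ∣ S j ω ∣
      pre = Live⇒PreLive j live

      θ : ℕ → ℝ
      θ i = β * β * (i · η)

      term : ∀ A → ind (A Subset.∈ S j ω) * w j ω A ≤ c * sum (λ i → ind (hi (τ i) j A ω))
      term A with em {P = A Subset.∈ S j ω}
      ... | no _ = ≤-trans (≤-reflexive (zeroˡ _)) (*-nonNegative 0≤c (sum-nonneg λ i → ind-nonneg (hi (τ i) j A ω)))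
      ... | yes A∈S = begin
        1# * w j ω A                                             ≈⟨ *-identityˡ _ ⟩
        w j ω A                                                  ≤⟨ layers-≥ 0≤c N θ (λ i → trans (distribˡ (β * β) η (i · η)) (+-comm _ _))
                                                                      -- The last heavy threshold is
                                                                      -- at least `N · η`, hence
                                                                      -- above every weight that can
                                                                      -- occur.
                                                                      (≤-trans (w≤sum-w₀ j pre A∈S) (≤-trans bound (τ≤ββτ (0≤· N)))) ⟩
        θ 0 + c * sum {N} (λ i → ind (θ (toℕ i) < w j ω A))      ≈⟨ trans (+-congʳ (zeroʳ (β * β))) (+-identityˡ _) ⟩
        c * sum {N} (λ i → ind (θ (toℕ i) < w j ω A))            ≤⟨ *-monoʳ-≤ 0≤c (sum-mono {N} λ i → ind-mono λ t<w → live , A∈S , t<w) ⟩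
        c * sum (λ i → ind (hi (τ i) j A ω))                     ∎

      W≤ : W j ω ≤ c * sum (λ i → v (τ i) j ω)
      W≤ = begin
        W j ω                                                    ≈⟨ W≈ j ω ⟩
        sum (λ A → ind (A Subset.∈ S j ω) * w j ω A)             ≤⟨ sum-mono term ⟩
        sum (λ A → c * sum (λ i → ind (hi (τ i) j A ω)))         ≈⟨ *-distribˡ-sum c (λ A → sum (λ i → ind (hi (τ i) j A ω))) ⟨
        c * sum (λ A → sum (λ i → ind (hi (τ i) j A ω)))         ≈⟨ *-congˡ (∑-comm (λ A i → ind (hi (τ i) j A ω))) ⟩
        c * sum (λ i → v (τ i) j ω)                              ∎

    -- Along the light thresholds each survivor's weight is overshot by at most `η`, and so is the
    -- average.
    ηZ≤ρ+η : ∀ j ω → η * ⟦ Z j ⟧ ω ≤ ρ j ω + η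
    ηZ≤ρ+η j ω with em {P = Live j ω}
    ... | no ¬live = begin
      η * ⟦ Z j ⟧ ω                        ≈⟨ *-congˡ (reflexive (⟦∑⟧ (λ i → X (τ i) j) ω)) ⟩
      η * sum (λ i → ⟦ X (τ i) j ⟧ ω)      ≈⟨ trans (*-congˡ (sum-zero λ i → trans (reflexive (⟦X⟧ (τ i) j ω)) (0/x≈0 (count-empty λ A h → ¬live (proj₁ h))))) (zeroʳ η) ⟩
      0#                                   ≤⟨ 0≤η ⟩
      η                                    ≈⟨ trans (+-congʳ (reflexive (ρ-stopped ¬live))) (+-identityˡ η) ⟨
      ρ j ω + η                            ∎
    ... | yes live = begin
      η * ⟦ Z j ⟧ ω                                  ≈⟨ *-congˡ (reflexive (⟦∑⟧ (λ i → X (τ i) j) ω)) ⟩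
      η * sum (λ i → ⟦ X (τ i) j ⟧ ω)                ≤⟨ *-monoʳ-≤ 0≤η (sum-mono λ i → X≤above/n live (0≤τ i)) ⟩
      η * sum (λ i → count (Above i) / n)            ≈⟨ trans (*-congˡ (sym (*-distribʳ-sum (n ⁻¹) (λ i → count (Above i))))) (sym (*-assoc η _ _)) ⟩
      (η * sum (λ i → count (Above i))) / n          ≤⟨ *-monoˡ-≤ (⁻¹-nonneg (n-pos live)) above≤ ⟩
      (W j ω + η * n) / n                            ≈⟨ distribʳ (n ⁻¹) (W j ω) (η * n) ⟩
      W j ω / n + (η * n) / n                        ≈⟨ +-cong (reflexive (≡.sym (ρ-live live))) (*-/-cancel (n-pos live)) ⟩
      ρ j ω + η                                      ∎
      where
      n = fromℕ ∣ S j ω ∣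
      pre = Live⇒PreLive j live

      Above : Fin N → Fin m → Set
      Above i A = A Subset.∈ S j ω × τ i < w j ω A

      term : ∀ A → η * sum (λ i → ind (Above i A)) ≤ ind (A Subset.∈ S j ω) * w j ω A + η * ind (A Subset.∈ S j ω)
      term A with em {P = A Subset.∈ S j ω}
      ... | no A∉S = ≤-reflexive (trans (trans (*-congˡ (sum-zero {N} λ i → reflexive (ind-no {Above i A} (A∉S ∘ proj₁)))) (zeroʳ η))
                                        (sym (trans (+-cong (zeroˡ _) (zeroʳ η)) (+-identityʳ 0#))))
      ... | yes A∈S = begin
        η * sum (λ i → ind (Above i A))                      ≤⟨ *-monoʳ-≤ 0≤η (sum-mono {N} λ i → ind-mono {Above i A} proj₂) ⟩
        η * sum {N} (λ i → ind (toℕ i · η < w j ω A))        ≈⟨ +-identityˡ _ ⟨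
        0# + η * sum {N} (λ i → ind (toℕ i · η < w j ω A))   ≤⟨ layers-≤ 0≤η N (_· η) (λ i → +-comm η (i · η)) (w-nonneg j pre A∈S) ⟩
        w j ω A + η                                          ≈⟨ +-cong (*-identityˡ _) (*-identityʳ η) ⟨
        1# * w j ω A + η * 1#                                ∎

      above≤ : η * sum (λ i → count (Above i)) ≤ W j ω + η * n
      above≤ = begin
        η * sum (λ i → count (Above i))                      ≈⟨ *-congˡ (∑-comm (λ i A → ind (Above i A))) ⟩
        η * sum (λ A → sum (λ i → ind (Above i A)))          ≈⟨ *-distribˡ-sum η (λ A → sum (λ i → ind (Above i A))) ⟩
        sum (λ A → η * sum (λ i → ind (Above i A)))          ≤⟨ sum-mono term ⟩
        sum (λ A → ind (A Subset.∈ S j ω) * w j ω A + η * ind (A Subset.∈ S j ω))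
          ≈⟨ ∑-distrib-+ (λ A → ind (A Subset.∈ S j ω) * w j ω A) (λ A → η * ind (A Subset.∈ S j ω)) ⟩
        sum (λ A → ind (A Subset.∈ S j ω) * w j ω A) + sum (λ A → η * ind (A Subset.∈ S j ω))
          ≈⟨ +-cong (W≈ j ω) (trans (*-congˡ (∣p∣≈count (S j ω))) (*-distribˡ-sum η (λ A → ind (A Subset.∈ S j ω)))) ⟨
        W j ω + η * n                                        ∎

    𝔼Z-decreasing : ∀ {s k G} → s ℕ.≤ k → Measurable (𝓔 s) G → 𝔼 (Z k) G ≤ 𝔼 (Z s) G
    𝔼Z-decreasing {s} {k} {G} s≤k mG = begin
      𝔼 (Z k) G                        ≈⟨ 𝔼-∑ (λ i → X (τ i) k) G ⟩
      sum (λ i → 𝔼 (X (τ i) k) G)      ≤⟨ sum-mono (λ i → ≡.subst (λ k → 𝔼 (X (τ i) k) G ≤ 𝔼 (X (τ i) s) G) (ℕ.m∸n+n≡m s≤k)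
                                            (supermartingale (0≤τ i) (k ℕ.∸ s) mG)) ⟩
      sum (λ i → 𝔼 (X (τ i) s) G)      ≈⟨ 𝔼-∑ (λ i → X (τ i) s) G ⟨
      𝔼 (Z s) G                        ∎

    -- Testing the conditional expectation on history events.

    module _ {s k : ℕ} (s≤k : s ℕ.≤ k) {Y : Ω → ℝ} (condExp : IsCondExp prob (𝓔 s) (ρ k) Y) where

      -- The margin `η` makes the failure quantitative: integrating over such an event `B` yields
      -- `η * P B ≤ 0#`.
      Exceeds : Event Ω
      Exceeds ω = c * ⟦ Z s ⟧ ω + η < Y ω

      private
        -- Measurability is part of the property because `Exceeds` compares two functions; it is
        -- assembled from pieces on which `Z s` is constant.
        Null : Event Ω → Set₁
        Null G = Measurable 𝓕 (G ∩ Exceeds) × P (G ∩ Exceeds) ≈ 0#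

        HiLoDecided : Event Ω → Set
        HiLoDecided G = ∀ i → (∀ A → Decides (hi (τ i) s A) G) × (∀ A → Decides (lo (τ i) s A) G)

        attain-HiLoDecided : Attainable-𝓔 s (lsuc 0ℓ) HiLoDecided
        attain-HiLoDecided = attain-𝓔-∀ s
          (λ i H⊆G (hd , ld) → (λ A → Decides-hereditary H⊆G (hd A)) , λ A → Decides-hereditary H⊆G (ld A))
          λ i → attain-𝓔-× s (λ H⊆G hd A → Decides-hereditary H⊆G (hd A))
            (attain-𝓔-∀ s (λ _ → Decides-hereditary) λ A → attain-𝓔-event s (hi-measurable (τ i) s A))
            (attain-𝓔-∀ s (λ _ → Decides-hereditary) λ A → attain-𝓔-event s (lo-measurable (τ i) s A))

        Null-split : ∀ {E G} → Measurable (𝓔 s) E → Measurable (𝓔 s) G → Null (G ∩ E) → Null (G ∩ ∁ E) → Null G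
        Null-split {E} {G} mE mG (m₁ , null₁) (m₂ , null₂) = mGX , (begin-equality
          P (G ∩ Exceeds)
            ≈⟨ P-split mGX (𝓔⊆𝓕 mE) ⟩
          P ((G ∩ Exceeds) ∩ E) + P ((G ∩ Exceeds) ∩ ∁ E)
            ≈⟨ +-cong (P-cong m₁ swap) (P-cong m₂ swap) ⟨
          P ((G ∩ E) ∩ Exceeds) + P ((G ∩ ∁ E) ∩ Exceeds)
            ≈⟨ trans (+-cong null₁ null₂) (+-identityʳ 0#) ⟩
          0# ∎)
          where
          swap : ∀ {B} → ((G ∩ B) ∩ Exceeds) ≐ ((G ∩ Exceeds) ∩ B)
          swap = (λ ((g , b) , x) → (g , x) , b) , λ ((g , x) , b) → (g , b) , x

          to : G ∩ Exceeds ⊆ ((G ∩ E) ∩ Exceeds) ∪ ((G ∩ ∁ E) ∩ Exceeds)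
          to {ω} (g , x) = [ (λ e → inj₁ ((g , e) , x)) , (λ ¬e → inj₂ ((g , ¬e) , x)) ]′ (toSum (em {P = E ω}))

          mGX : Measurable 𝓕 (G ∩ Exceeds)
          mGX = ≐-closed ((λ { (inj₁ ((g , _) , x)) → g , x ; (inj₂ ((g , _) , x)) → g , x }) , to) (∪-measurable m₁ m₂)

        atom : ∀ {G} → Measurable (𝓔 s) G → HiLoDecided G → Dec (Satisfiable G) → Null G
        atom {G} mG decided (no empty) = m∅ , P-∅ m∅ λ ω (g , _) → empty (ω , g)
          where
          m∅ : Measurable 𝓕 (G ∩ Exceeds)
          m∅ = ≐-closed ((λ ()) , λ (g , _) → contradiction (_ , g) empty) (const-measurable (Fin 0))
        atom {G} mG decided (yes (ω₀ , g₀)) = ≐-closed G′≐ mG′ , trans (P-cong (≐-closed G′≐ mG′) (proj₂ G′≐ , proj₁ G′≐)) PG′≈0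
          where
          q₀ = c * ⟦ Z s ⟧ ω₀

          X-constant : ∀ i {ω} → ω ∈ G → ⟦ X (τ i) s ⟧ ω ≈ ⟦ X (τ i) s ⟧ ω₀
          X-constant i {ω} g = trans (reflexive (⟦X⟧ (τ i) s ω)) (trans
            (/-cong v-constant (+-cong v-constant u-constant)) (reflexive (≡.sym (⟦X⟧ (τ i) s ω₀))))
            where
            hd = proj₁ (decided i)
            ld = proj₂ (decided i)
            v-constant : v (τ i) s ω ≈ v (τ i) s ω₀
            v-constant = ≤-antisym (count-mono λ A → Decides-constant (hd A) g g₀) (count-mono λ A → Decides-constant (hd A) g₀ g)
            u-constant : u (τ i) s ω ≈ u (τ i) s ω₀
            u-constant = ≤-antisym (count-mono λ A → Decides-constant (ld A) g g₀) (count-mono λ A → Decides-constant (ld A) g₀ g)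

          q-constant : ∀ {ω} → ω ∈ G → c * ⟦ Z s ⟧ ω ≈ q₀
          q-constant {ω} g = *-congˡ (trans (reflexive (⟦∑⟧ (λ i → X (τ i) s) ω)) (trans (sum-cong λ i → X-constant i g)
            (reflexive (≡.sym (⟦∑⟧ (λ i → X (τ i) s) ω₀)))))

          -- With `Z s` frozen at its value on `G`, `Exceeds` becomes a superlevel event of `Y` at a
          -- constant. It therefore lies in `𝓔 s` and can be used to test the conditional
          -- expectation.
          G′ : Event Ω
          G′ = G ∩ ∁ (U ∩ λ ω → Y ω ≤ q₀ + η)

          mG′-𝓔 : Measurable (𝓔 s) G′
          mG′-𝓔 = ∩-𝓔-measurable s mG (complement (proj₁ condExp (q₀ + η)))

          mG′ : Measurable 𝓕 G′
          mG′ = 𝓔⊆𝓕 mG′-𝓔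

          G′≐ : G′ ≐ (G ∩ Exceeds)
          G′≐ = (λ (g , ¬Y≤) → g , λ Y≤ → ¬Y≤ (tt , ≤-trans Y≤ (≤-reflexive (+-congʳ (q-constant g)))))
              , λ (g , x) → g , λ (_ , Y≤) → x (≤-trans Y≤ (≤-reflexive (sym (+-congʳ (q-constant g)))))

          -- `x` is the common integral of `Y` and `ρ k` over `G′`: large because `Y` exceeds
          -- `q₀ + η` there, small because `ρ k` lies below `c * Z k`, whose expectation has not
          -- grown since round `s`.
          q₀P+ηP≤q₀P : η * P G′ + q₀ * P G′ ≤ 0# + q₀ * P G′
          q₀P+ηP≤q₀P = let x , ρ-integral , Y-integral = proj₂ condExp mG′-𝓔 in begin
            η * P G′ + q₀ * P G′      ≈⟨ trans (+-comm _ _) (sym (distribʳ (P G′) q₀ η)) ⟩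
            (q₀ + η) * P G′           ≤⟨ IsIntegral-≥ mG′ (+-nonneg (*-nonNegative 0≤c (Z-nonneg s ω₀)) 0≤η)
                                           (λ (_ , ¬Y≤) → <⇒≤ λ Y≤ → ¬Y≤ (tt , Y≤)) Y-integral ⟩
            x                         ≤⟨ IsIntegral-≤ (c ⊛ Z k) mG′ (λ {ω} _ → *-nonNegative 0≤c (Z-nonneg k ω)) (λ {ω} _ → ρ≤cZ k ω) ρ-integral ⟩
            c * 𝔼 (Z k) G′            ≤⟨ *-monoʳ-≤ 0≤c (𝔼Z-decreasing s≤k mG′-𝓔) ⟩
            c * 𝔼 (Z s) G′            ≤⟨ 𝔼-mono (c ⊛ Z s) (const q₀) mG′ (λ (g , _) → ≤-reflexive (q-constant g)) ⟩
            q₀ * P G′                 ≈⟨ +-identityˡ _ ⟨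
            0# + q₀ * P G′            ∎

          PG′≈0 : P G′ ≈ 0#
          PG′≈0 = ≤-antisym (begin
            P G′             ≈⟨ *-/-cancel 0<η ⟨
            (P G′ * η) / η   ≈⟨ *-congʳ (*-comm (P G′) η) ⟩
            (η * P G′) / η   ≤⟨ *-monoˡ-≤ (⁻¹-nonneg 0<η) (+-cancelʳ-≤ (q₀ * P G′) q₀P+ηP≤q₀P) ⟩
            0# / η           ≈⟨ 0/x≈0 refl ⟩
            0#               ∎) (P-nonneg mG′)

      Exceeds-null : Measurable 𝓕 Exceeds × P Exceeds ≈ 0#
      Exceeds-null = let mX , null = attain-HiLoDecided Null Null-split (λ mG decided → atom mG decided em) universe in
        ≐-closed (proj₂ , (tt ,_)) mX , trans (sym (P-cong mX (proj₂ , (tt ,_)))) null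

  -- Letting the mesh tend to 0.

  module Conclusion {s k : ℕ} (s<k : s ℕ.< k) {Y : Ω → ℝ} (condExp : IsCondExp prob (𝓔 s) (ρ k) Y) where
    private
      -- The added 1 keeps the mesh positive when all initial weights are 0.
      C : ℝ
      C = sum w₀ + 1#

      0<C : 0# < C
      0<C = <-≤-trans 0<1 (≤-trans (x≤x+nonneg (sum-nonneg 0≤w₀)) (≤-reflexive (+-comm 1# _)))

      -- With `suc n` thresholds the grid spans `C` for every `n`, so its range stays fixed while
      -- the mesh shrinks.
      η : ℕ → ℝ
      η n = C / fromℕ (suc n)

      Nη≈C : ∀ n → suc n · η n ≈ C
      Nη≈C n = trans (·-fromℕ (suc n) (η n)) (/-*-cancel (fromℕ-suc-pos n))

      0<η : ∀ n → 0# < η n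
      0<η n η≤0 = 0<C (begin
        C                        ≈⟨ /-*-cancel (fromℕ-suc-pos n) ⟨
        η n * fromℕ (suc n)      ≤⟨ *-monoˡ-≤ (fromℕ-nonneg (suc n)) η≤0 ⟩
        0# * fromℕ (suc n)       ≈⟨ zeroˡ _ ⟩
        0#                       ∎)

      module Gridₙ (n : ℕ) = Grid (0<η n) (suc n) (≤-trans (x≤x+nonneg 0≤1) (≤-reflexive (sym (Nη≈C n))))

      Bad : ℕ → Event Ω
      Bad n = Gridₙ.Exceeds n (ℕ.<⇒≤ s<k) condExp

      Bad-null : ∀ n → Measurable 𝓕 (Bad n) × P (Bad n) ≈ 0#
      Bad-null n = Gridₙ.Exceeds-null n (ℕ.<⇒≤ s<k) condExp

      good-bound : ∀ {ω} n → ¬ Bad n ω → Y ω ≤ β * β * ρ s ω + ((β * β + 1#) * C) / fromℕ (suc n)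
      good-bound {ω} n ¬bad = begin
        Y ω                                            ≤⟨ decidable-stable (_ ≤? _) ¬bad ⟩
        β * β * η n * ⟦ Z s ⟧ ω + η n                  ≈⟨ +-congʳ (*-assoc (β * β) (η n) _) ⟩
        β * β * (η n * ⟦ Z s ⟧ ω) + η n                ≤⟨ +-monoˡ-≤ (η n) (*-monoʳ-≤ (*-nonNegative 0≤β 0≤β) (ηZ≤ρ+η s ω)) ⟩
        β * β * (ρ s ω + η n) + η n                    ≈⟨ solve 4 (λ b r C f → b :* (r :+ C :* f) :+ C :* f := b :* r :+ (b :* (C :* f) :+ C :* f)) refl (β * β) (ρ s ω) C (fromℕ (suc n) ⁻¹) ⟩
        β * β * ρ s ω + (β * β * η n + η n)            ≈⟨ +-congˡ (trans (*-congʳ (distribʳ C (β * β) 1#)) (trans (distribʳ _ _ _) (+-cong (*-assoc _ C _) (*-congʳ (*-identityˡ C))))) ⟨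
        β * β * ρ s ω + ((β * β + 1#) * C) / fromℕ (suc n) ∎
        where open Gridₙ n

    almostSurely : AlmostSurely prob (λ ω → Y ω ≤ β * β * ρ s ω)
    almostSurely = ⋃ ℕ Bad , ⋃-measurable (proj₁ ∘ Bad-null) , null-⋃ (proj₁ ∘ Bad-null) (proj₂ ∘ Bad-null) , outside-null
      where
      outside-null : ∁ (λ ω → Y ω ≤ β * β * ρ s ω) ⊆ ⋃ ℕ Bad
      -- An outcome outside every `Bad n` satisfies the bound with an error of order 1 / (n + 1) for
      -- all `n`, hence without error; countably many null events are discarded.
      outside-null ¬bound = decidable-stable em λ good → ¬bound
        (limit-≤ (*-nonNegative (+-nonneg (*-nonNegative 0≤β 0≤β) 0≤1) (<⇒≤ 0<C)) λ n → good-bound n λ bad → good (n , bad))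

theorem3p1 :
    (∀ {ℓ} → ExcludedMiddle ℓ) →
    (R : RealNumbers) →
    let open RealNumbers R
        open Probability R
        open Game R
    in
    (Ω : Set) (prob : ProbabilitySpace Ω) (β : ℝ) → 1# ≤ β →
    (m : ℕ) (w₀ : Fin m → ℝ) → (∀ A → 0# ≤ w₀ A) →
    (play : Play Ω m) → IsSamplingGame prob β w₀ play →
    let open Play play in
    (s k : ℕ) → s ℕ.< k →
    (E[ρₖ∣𝓔ₛ] : Ω → ℝ) → IsCondExp prob (𝓔 s) (ρ k) E[ρₖ∣𝓔ₛ] →
    AlmostSurely prob (λ ω → E[ρₖ∣𝓔ₛ] ω ≤ β * β * ρ s ω)
theorem3p1 em R Ω prob β 1≤β m w₀ 0≤w₀ play game s k s<k Y condExp =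
  SamplingGame.Conclusion.almostSurely em R prob 1≤β 0≤w₀ play game s<k condExp
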